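{- Let $k\ge1$ and $N\ge0$. For $1\le i\le k$, $$\overline{\mathcal E}_{k,i}(N)=a^Nq^{\binom{N+1}{2}}(-1/a)_N\sum_{n=-N}^{N}(-1)^n\frac{q^{kn^2+n(k-i)-\binom{n}{2}}}{(q)_{N-n}(q)_{N+n}},$$ and for $0\le i<k$, $$\overline{\Gamma}_{k,i}(N)=a^Nq^{\binom{N}{2}}(-1/a)_N\sum_{n=-N}^{N-1}(-1)^n\frac{q^{kn^2+n(k-i)-\binom{n+1}{2}}}{(q)_{N-n-1}(q)_{N+n}}.$$
   Context: $(x)_n=\prod_{m=0}^{n-1}(1-xq^m)$ for $n\ge0$; $\binom{n}{2}=n(n-1)/2$ for all integers $n$. Lattice paths: paths in the first quadrant starting on the $y$-axis, ending on the $x$-axis, using unit steps North-East $(x,y)\to(x+1,y+1)$, South-East $(x,y)\to(x+1,y-1)$, South $(x,y)\to(x,y-1)$, East $(x,0)\to(x+1,0)$ (East steps only at height 0). A South step may only occur immediately after a North-East step. A path is either empty or ends with a South-East or South step. Special $(k,i)$-conditions: start at $(0,k-i)$, all vertices have $y$-coordinate $<k$. A peak is a vertex preceded by a North-East step and followed by a South or South-East step; the major index $\mathrm{maj}(P)$ is the sum of the $x$-coordinates of the peaks; $s(P)$ is the number of South steps. $\overline{\mathcal E}_{k,i}(N)=\sum_P q^{\mathrm{maj}(P)}a^{s(P)}$ over paths $P$ satisfying the special $(k,i)$-conditions with exactly $N$ peaks. For $0\le i<k$, $\overline{\Gamma}_{k,i}(N)=\sum_P q^{\mathrm{maj}(P)-N}a^{s(P)}$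 over paths $P$ satisfying the special $(k,i+1)$-conditions with exactly $N$ peaks whose first step is North-East. -}

module Defs where

open import Data.Nat as ℕ using (ℕ; zero; suc; _<_; _≤_; _∸_; _≡ᵇ_; _<ᵇ_)
open import Data.Nat.Divisibility using (_∣?_)
open import Data.Integer as ℤ using (ℤ; +_; ∣_∣; -_; _/ℕ_)
open import Data.Bool using (Bool; true; false; _∧_; if_then_else_; T)
open import Data.List using (List; []; _∷_; length; map; upTo; foldr)
open import Data.List.Membership.Propositional using (_∈_)
open import Data.List.Relation.Unary.Unique.Propositional using (Unique)
open import Data.Product using (Σ; _×_)
open import Function.Bundles using (_⇔_)
open import Relation.Nullary.Decidable using (⌊_⌋)
open import Relation.Binary.PropositionalEquality using (_≡_)

-- NE : (x,y)→(x+1,y+1), SE : (x,y)→(x+1,y-1), S : (x,y)→(x,y-1),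
-- E : (x,0)→(x+1,0).
data Step : Set where
  NE SE S E : Step

Path : Set
Path = List Step

dx : Step → ℕ
dx S = 0
dx _ = 1

isNE : Step → Bool
isNE NE = true
isNE _  = false

endsOK : Path → Bool
endsOK []            = true
endsOK (SE ∷ [])     = true
endsOK (S ∷ [])      = true
endsOK (_ ∷ [])      = false
endsOK (_ ∷ p@(_ ∷ _)) = endsOK p

walkOK : ℕ → Bool → ℕ → Path → Bool
walkOK k prevNE h []           = h ≡ᵇ 0
walkOK k prevNE h (NE ∷ p)     = (suc h <ᵇ k) ∧ walkOK k true (suc h) p
walkOK k prevNE zero (SE ∷ p)  = false
walkOK k prevNE (suc h) (SE ∷ p) = walkOK k false h p
walkOK k prevNE zero (S ∷ p)   = false
walkOK k prevNE (suc h) (S ∷ p) = prevNE ∧ walkOK k false h p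
walkOK k prevNE zero (E ∷ p)   = walkOK k false zero p
walkOK k prevNE (suc h) (E ∷ p) = false

-- Special (k,i)-conditions: start at (0, k-i), all vertices have y < k
-- (the start vertex included), plus the general path conditions.
-- (Used only with 1 ≤ i ≤ k, so k ∸ i is the honest k - i.)
specialOK : ℕ → ℕ → Path → Bool
specialOK k i p = ((k ∸ i) <ᵇ k) ∧ walkOK k false (k ∸ i) p ∧ endsOK p

peakXs : ℕ → Path → List ℕ
peakXs x []                  = []
peakXs x (NE ∷ p@(S ∷ _))    = suc x ∷ peakXs (suc x) p
peakXs x (NE ∷ p@(SE ∷ _))   = suc x ∷ peakXs (suc x) p
peakXs x (st ∷ p)            = peakXs (x ℕ.+ dx st) p

peaks : Path → ℕ
peaks p = length (peakXs 0 p)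

maj : Path → ℕ
maj p = foldr ℕ._+_ 0 (peakXs 0 p)

sCount : Path → ℕ
sCount []      = 0
sCount (S ∷ p) = suc (sCount p)
sCount (_ ∷ p) = sCount p

firstNE : Path → Bool
firstNE []      = false
firstNE (s ∷ _) = isNE s

-- Formal power series in q and a with integer coefficients:
-- F m j = coefficient of q^m a^j.

PS : Set
PS = ℕ → ℕ → ℤ

sumℕ : (ℕ → ℤ) → ℕ → ℤ
sumℕ f n = foldr (λ t acc → f t ℤ.+ acc) (+ 0) (upTo n)

0ₚ : PS
0ₚ m j = + 0

_+ₚ_ : PS → PS → PS
(f +ₚ g) m j = f m j ℤ.+ g m j

_*ₚ_ : PS → PS → PS
(f *ₚ g) m j = sumℕ (λ s → sumℕ (λ t → f s t ℤ.* g (m ∸ s) (j ∸ t)) (suc j)) (suc m)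

scaleₚ : ℤ → PS → PS
scaleₚ c f m j = c ℤ.* f m j

prodₚ : List PS → PS
prodₚ = foldr _*ₚ_ (λ m j → if (m ≡ᵇ 0) ∧ (j ≡ᵇ 0) then + 1 else + 0)

sumₚ : List PS → PS
sumₚ = foldr _+ₚ_ 0ₚ

mono : ℕ → ℕ → PS
mono e d m j = if (m ≡ᵇ e) ∧ (j ≡ᵇ d) then + 1 else + 0

-- q^e for an integer exponent e (only ever used with e ≥ 0)
qZ : ℤ → PS
qZ e m j = if ⌊ e ℤ.≟ + m ⌋ ∧ (j ≡ᵇ 0) then + 1 else + 0

-- 1/(1 - q^r) = Σ_t q^{r t}, for r ≥ 1
geom : ℕ → PS
geom r m j = if ⌊ r ∣? m ⌋ ∧ (j ≡ᵇ 0) then + 1 else + 0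

invQPoch : ℕ → PS
invQPoch n = prodₚ (map (λ m → geom (suc m)) (upTo n))

-- a^N (-1/a)_N = a^N Π_{m<N} (1 + q^m/a) = Π_{m<N} (a + q^m)
aNminusPoch : ℕ → PS
aNminusPoch N = prodₚ (map (λ m → mono 0 1 +ₚ mono m 0) (upTo N))

-- binomial (n choose 2) = n(n-1)/2 for integers n (n(n-1) is even)
binom2 : ℤ → ℤ
binom2 n = (n ℤ.* (n ℤ.- + 1)) /ℕ 2

binom2ℕ : ℕ → ℕ
binom2ℕ n = (n ℕ.* (n ∸ 1)) ℕ./ 2

rangeZ : ℕ → ℕ → List ℤ
rangeZ N len = map (λ t → + t ℤ.- + N) (upTo len)

-- "Σ_{P with F P} q^{w P} a^{s P} = G" as formal power series: for all
-- m, j the set of paths P with F P, w P = m, s P = j is finite and its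
-- cardinality (given by a duplicate-free complete enumeration) is G m j.
-- The q-weight w is integer-valued (for \bar Γ it is maj - N).
GenFunIs : (Path → Set) → (Path → ℤ) → (Path → ℕ) → PS → Set
GenFunIs F w s G = ∀ m j → Σ (List Path) λ ls →
  Unique ls ×
  (∀ P → (P ∈ ls) ⇔ (F P × w P ≡ + m × s P ≡ j)) ×
  (+ length ls ≡ G m j)

EPath : ℕ → ℕ → ℕ → Path → Set
EPath k i N P = T (specialOK k i P) × peaks P ≡ N

GPath : ℕ → ℕ → ℕ → Path → Set
GPath k i N P = T (specialOK k (suc i) P) × peaks P ≡ N × T (firstNE P)

rhsE : ℕ → ℕ → ℕ → PS
rhsE k i N =
  (mono (binom2ℕ (suc N)) 0 *ₚ aNminusPoch N) *ₚ
  sumₚ (map (λ n →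
      scaleₚ ((- + 1) ℤ.^ ∣ n ∣)
        (qZ (+ k ℤ.* n ℤ.* n ℤ.+ n ℤ.* (+ k ℤ.- + i) ℤ.- binom2 n)
         *ₚ (invQPoch ∣ + N ℤ.- n ∣ *ₚ invQPoch ∣ + N ℤ.+ n ∣)))
    (rangeZ N (suc (2 ℕ.* N))))

rhsG : ℕ → ℕ → ℕ → PS
rhsG k i N =
  (mono (binom2ℕ N) 0 *ₚ aNminusPoch N) *ₚ
  sumₚ (map (λ n →
      scaleₚ ((- + 1) ℤ.^ ∣ n ∣)
        (qZ (+ k ℤ.* n ℤ.* n ℤ.+ n ℤ.* (+ k ℤ.- + i) ℤ.- binom2 (n ℤ.+ + 1))
         *ₚ (invQPoch ∣ + N ℤ.- n ℤ.- + 1 ∣ *ₚ invQPoch ∣ + N ℤ.+ n ∣)))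
    (rangeZ N (2 ℕ.* N)))

{-# OPTIONS --safe #-}
module Submission where

-- Index both families by the starting height h and write E_h(N), Γ_h(N). Removing the first
-- step (for Γ, the first NE step together with a following S or SE) gives
--   E_h(N) = q^N E_{h-1}(N) + q^N Γ_h(N)  (h ≥ 1),    E_0(N) = q^N E_0(N) + q^N Γ_0(N)  (N ≥ 1),
--   Γ_h(N) = q^N Γ_{h+1}(N) + (a + q^{N-1}) E_h(N-1)  (h < k-1),    Γ_{k-1}(N) = 0,
-- and E_0(0) = 1, Γ_h(0) = 0, which determine everything. Since binom(n+1,2) = binom(n,2) + n,
-- both right-hand sides have the same exponents kn² + nh − binom(n,2), so they satisfy the
-- recurrences involving neighbouring heights term by term, using
-- 1/(q)_{r+1} = 1/(q)_r + q^{r+1}/(q)_{r+1}. The two boundary relations follow from the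
-- symmetries n ↦ −n and n ↦ −1−n of the sums.

open import Defs
open import Algebra.Bundles using (CommutativeRing)
import Algebra.Properties.CommutativeSemigroup as CommutativeSemigroupProperties
import Algebra.Properties.Ring as RingProperties
import Algebra.Properties.Semiring.Exp as Exp
import Algebra.Solver.Ring.NaturalCoefficients.Default as SemiringSolver
open import Data.Bool using (T; true; false; if_then_else_; _∧_)
open import Data.Bool.Properties using (T-∧)
open import Data.Empty using (⊥-elim)
open import Data.Integer as ℤ using (ℤ; +_; -[1+_]; ∣_∣; _-_)
import Data.Integer.Properties as ℤ
open import Data.Integer.Tactic.RingSolver using (solve-∀)
open import Data.List using (List; []; _∷_; _∷ʳ_; _++_; applyUpTo; foldr; length; map; upTo)
open import Data.List.Membership.Propositional using (_∈_)
open import Data.List.Membership.Propositional.Properties using (∈-map⁺; ∈-map⁻; ∈-++⁺ˡ; ∈-++⁺ʳ; ∈-++⁻)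
open import Data.List.Properties using (++-cancelˡ; foldr-map; length-++; length-map; map-++; upTo-∷ʳ)
open import Data.List.Relation.Unary.All using ([])
open import Data.List.Relation.Unary.AllPairs using ([]; _∷_)
open import Data.List.Relation.Unary.Any using (here; there)
open import Data.List.Relation.Unary.Unique.Propositional using (Unique)
import Data.List.Relation.Unary.Unique.Propositional.Properties as Unique
open import Data.Nat as ℕ using (ℕ; zero; suc; z≤n; s≤s; _≤_; _<_; _∸_; _≡ᵇ_)
open import Data.Nat.Divisibility using (_∣?_; _∣0; ∣m+n∣m⇒∣n; ∣m∣n⇒∣m+n; ∣-refl; >⇒∤)
import Data.Nat.DivMod as ℕ
open import Data.Nat.Induction using (<-rec)
import Data.Nat.Properties as ℕ
import Data.Nat.Tactic.RingSolver as ℕSolver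
open import Data.Product using (Σ; ∃; _×_; _,_; proj₁; proj₂)
open import Data.Sum using (_⊎_; inj₁; inj₂)
open import Data.Unit using (tt)
open import Function using (Equivalence; _⇔_; _∘_; flip; id; mk⇔)
open import Level using (_⊔_)
open import Relation.Binary.PropositionalEquality as ≡ using (_≡_)
import Relation.Binary.Reasoning.Setoid as SetoidReasoning
open import Relation.Nullary using (¬_)
open import Relation.Nullary.Decidable using (⌊_⌋; dec-false; dec-true; does-⇔; isYes≗does)

-- The recurrences are used in a fixed order: for given N, Γ_h(N) is settled downwards from height k
-- - 1 using only E(N - 1), and then E_h(N) upwards from height 0 using Γ(N). At height 0 the series
-- E_0(N) stands on both sides. Its factor q^N with N ≥ 1 raises the degree, so each coefficient
-- depends only on lower ones and no division by 1 - q^N occurs. The case N = 0 is separate: the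
-- factor is then 1, and an `E` step in front of the empty path does not give a path. On the
-- algebraic side both families are indexed by z = h + 1. The sum for E still makes sense at z = 0,
-- a height -1 at which no path starts; n ↦ -n identifies it with height 0, which turns the general
-- step between neighbouring heights into the boundary relation. At the top, n ↦ -1 - n gives only 2
-- Γ_{k-1}(N) = 0, and the integer coefficients allow the 2 to be cancelled.

-- Sums over t + u = n; unlike a sum over t with u = n ∸ t, these need no subtraction.
module AntidiagonalSums {c ℓ} (R : CommutativeRing c ℓ) where
  open CommutativeRing R
  open CommutativeSemigroupProperties +-commutativeSemigroup using (interchange; x∙yz≈y∙xz)

  Σᵈ : ℕ → (ℕ → ℕ → Carrier) → Carrier
  Σᵈ zero    F = F 0 0
  Σᵈ (suc n) F = F 0 (suc n) + Σᵈ n (F ∘ suc)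

  Σᵈ-cong : ∀ n {F G} → (∀ t u → t ℕ.+ u ≡ n → F t u ≈ G t u) → Σᵈ n F ≈ Σᵈ n G
  Σᵈ-cong zero    F≈G = F≈G 0 0 ≡.refl
  Σᵈ-cong (suc n) F≈G =
    +-cong (F≈G 0 (suc n) ≡.refl) (Σᵈ-cong n λ t u eq → F≈G (suc t) u (≡.cong suc eq))

  Σᵈ-+ : ∀ n F G → Σᵈ n (λ t u → F t u + G t u) ≈ Σᵈ n F + Σᵈ n G
  Σᵈ-+ zero    F G = refl
  Σᵈ-+ (suc n) F G = trans (+-congˡ (Σᵈ-+ n (F ∘ suc) (G ∘ suc))) (interchange _ _ _ _)

  Σᵈ-*ˡ : ∀ n x F → Σᵈ n (λ t u → x * F t u) ≈ x * Σᵈ n F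
  Σᵈ-*ˡ zero    x F = refl
  Σᵈ-*ˡ (suc n) x F = trans (+-congˡ (Σᵈ-*ˡ n x (F ∘ suc))) (sym (distribˡ x _ _))

  Σᵈ-zero : ∀ n → Σᵈ n (λ _ _ → 0#) ≈ 0#
  Σᵈ-zero zero    = refl
  Σᵈ-zero (suc n) = trans (+-identityˡ _) (Σᵈ-zero n)

  Σᵈ-last : ∀ n F → Σᵈ (suc n) F ≈ F (suc n) 0 + Σᵈ n (λ t u → F t (suc u))
  Σᵈ-last zero    F = +-comm _ _
  Σᵈ-last (suc n) F = trans (+-congˡ (Σᵈ-last n (F ∘ suc))) (x∙yz≈y∙xz _ _ _)

  Σᵈ-swap : ∀ n F → Σᵈ n F ≈ Σᵈ n (flip F)
  Σᵈ-swap zero    F = refl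
  Σᵈ-swap (suc n) F = trans (+-congˡ (Σᵈ-swap n (F ∘ suc))) (sym (Σᵈ-last n (flip F)))

  foldr-applyUpTo : ∀ n f (g : ℕ → Carrier) →
    foldr (λ t acc → g t + acc) 0# (applyUpTo f (suc n)) ≈ Σᵈ n (λ t _ → g (f t))
  foldr-applyUpTo zero    f g = +-identityʳ _
  foldr-applyUpTo (suc n) f g = +-congˡ (foldr-applyUpTo n (f ∘ suc) g)

-- Formal power series over a commutative ring.

module PowerSeries {c ℓ} (R : CommutativeRing c ℓ) where
  open CommutativeRing R
  open AntidiagonalSums R
  open SetoidReasoning setoid

  infixl 7 _⊛_
  infix 4 _≋_

  _≋_ : (f g : ℕ → Carrier) → Set ℓ
  f ≋ g = ∀ n → f n ≈ g n

  _⊛_ : (f g : ℕ → Carrier) → ℕ → Carrier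
  (f ⊛ g) n = Σᵈ n (λ t u → f t * g u)

  const : Carrier → ℕ → Carrier
  const x zero    = x
  const x (suc _) = 0#

  shift : (ℕ → Carrier) → ℕ → Carrier
  shift f zero    = 0#
  shift f (suc n) = f n

  ⊛-cong : ∀ {f f′ g g′} → f ≋ f′ → g ≋ g′ → f ⊛ g ≋ f′ ⊛ g′
  ⊛-cong f≋f′ g≋g′ n = Σᵈ-cong n λ t u _ → *-cong (f≋f′ t) (g≋g′ u)

  ⊛-comm : ∀ f g → f ⊛ g ≋ g ⊛ f
  ⊛-comm f g n = trans (Σᵈ-swap n _) (Σᵈ-cong n λ t u _ → *-comm _ _)

  ⊛-distribʳ : ∀ h f g → (λ n → f n + g n) ⊛ h ≋ (λ n → (f ⊛ h) n + (g ⊛ h) n)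
  ⊛-distribʳ h f g n = trans (Σᵈ-cong n λ t u _ → distribʳ _ _ _) (Σᵈ-+ n _ _)

  ⊛-distribˡ : ∀ f g h → f ⊛ (λ n → g n + h n) ≋ (λ n → (f ⊛ g) n + (f ⊛ h) n)
  ⊛-distribˡ f g h n = trans (Σᵈ-cong n λ t u _ → distribˡ _ _ _) (Σᵈ-+ n _ _)

  scale-⊛ : ∀ x f g → (λ n → x * f n) ⊛ g ≋ (λ n → x * (f ⊛ g) n)
  scale-⊛ x f g n = trans (Σᵈ-cong n λ t u _ → *-assoc _ _ _) (Σᵈ-*ˡ n x _)

  -- Induction on the coefficient index with `f` varying: the tail of `f ⊛ g` is `f 0` times the
  -- tail of `g` plus `(f ∘ suc) ⊛ g`, so the hypothesis is applied to `f ∘ suc`.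
  ⊛-assoc : ∀ f g h → (f ⊛ g) ⊛ h ≋ f ⊛ (g ⊛ h)
  ⊛-assoc f g h zero    = *-assoc _ _ _
  ⊛-assoc f g h (suc n) = begin
    f 0 * g 0 * h (suc n) + ((λ m → f 0 * g (suc m) + ((f ∘ suc) ⊛ g) m) ⊛ h) n
      ≈⟨ +-cong (*-assoc _ _ _) (⊛-distribʳ h _ ((f ∘ suc) ⊛ g) n) ⟩
    f 0 * (g 0 * h (suc n)) + (((λ m → f 0 * g (suc m)) ⊛ h) n + (((f ∘ suc) ⊛ g) ⊛ h) n)
      ≈⟨ +-congˡ (+-cong (scale-⊛ (f 0) (g ∘ suc) h n) (⊛-assoc (f ∘ suc) g h n)) ⟩
    f 0 * (g 0 * h (suc n)) + (f 0 * ((g ∘ suc) ⊛ h) n + ((f ∘ suc) ⊛ (g ⊛ h)) n)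
      ≈⟨ +-assoc _ _ _ ⟨
    f 0 * (g 0 * h (suc n)) + f 0 * ((g ∘ suc) ⊛ h) n + ((f ∘ suc) ⊛ (g ⊛ h)) n
      ≈⟨ +-congʳ (distribˡ _ _ _) ⟨
    f 0 * (g ⊛ h) (suc n) + ((f ∘ suc) ⊛ (g ⊛ h)) n ∎

  shift-⊛ : ∀ f g → shift f ⊛ g ≋ shift (f ⊛ g)
  shift-⊛ f g zero    = zeroˡ _
  shift-⊛ f g (suc n) = trans (+-congʳ (zeroˡ _)) (+-identityˡ _)

  const-⊛ : ∀ x f → const x ⊛ f ≋ (λ n → x * f n)
  const-⊛ x f zero    = refl
  const-⊛ x f (suc n) = trans
    (+-congˡ (trans (Σᵈ-cong n λ t u _ → zeroˡ _) (Σᵈ-zero n))) (+-identityʳ _)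

  ⊛-identityˡ : ∀ f → const 1# ⊛ f ≋ f
  ⊛-identityˡ f n = trans (const-⊛ 1# f n) (*-identityˡ _)

  commutativeRing : CommutativeRing c ℓ
  commutativeRing = record
    { Carrier = ℕ → Carrier
    ; _≈_ = _≋_
    ; _+_ = λ f g n → f n + g n
    ; _*_ = _⊛_
    ; -_ = λ f n → - f n
    ; 0# = λ _ → 0#
    ; 1# = const 1#
    ; isCommutativeRing = record
      { isRing = record
        { +-isAbelianGroup = record
          { isGroup = record
            { isMonoid = record
              { isSemigroup = record
                { isMagma = record
                  { isEquivalence = record
                    { refl = λ _ → refl
                    ; sym = λ p n → sym (p n)
                    ; trans = λ p q n → trans (p n) (q n)
                    }
                  ; ∙-cong = λ p q n → +-cong (p n) (q n)
                  }
                ; assoc = λ _ _ _ _ → +-assoc _ _ _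
                }
              ; identity = (λ _ _ → +-identityˡ _) , (λ _ _ → +-identityʳ _)
              }
            ; inverse = (λ _ _ → -‿inverseˡ _) , (λ _ _ → -‿inverseʳ _)
            ; ⁻¹-cong = λ p n → -‿cong (p n)
            }
          ; comm = λ _ _ _ → +-comm _ _
          }
        ; *-cong = ⊛-cong
        ; *-assoc = ⊛-assoc
        ; *-identity = ⊛-identityˡ , λ f n → trans (⊛-comm f _ n) (⊛-identityˡ f n)
        ; distrib = ⊛-distribˡ , ⊛-distribʳ
        }
      ; *-comm = ⊛-comm
      }
    }

-- Binomials (n choose 2) and the exponents of q.

-- The division-free (n choose 2). Its recursion is what splits the prefactor of E into q^N times
-- that of Γ.
triangle : ℕ → ℕ
triangle zero    = 0
triangle (suc n) = n ℕ.+ triangle n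

triangle-double : ∀ n → suc n ℕ.* n ≡ triangle (suc n) ℕ.* 2
triangle-double zero    = ≡.refl
triangle-double (suc n) = ≡.trans (lhs n)
  (≡.trans (≡.cong (ℕ._+ (suc n ℕ.* 2)) (triangle-double n)) (rhs n (triangle n)))
  where
  lhs : ∀ n → (1 ℕ.+ (1 ℕ.+ n)) ℕ.* (1 ℕ.+ n) ≡ (1 ℕ.+ n) ℕ.* n ℕ.+ (1 ℕ.+ n) ℕ.* 2
  lhs = ℕSolver.solve-∀
  rhs : ∀ n t → (n ℕ.+ t) ℕ.* 2 ℕ.+ (1 ℕ.+ n) ℕ.* 2 ≡ ((1 ℕ.+ n) ℕ.+ (n ℕ.+ t)) ℕ.* 2
  rhs = ℕSolver.solve-∀

binom2ℕ-triangle : ∀ n → binom2ℕ n ≡ triangle n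
binom2ℕ-triangle zero    = ≡.refl
binom2ℕ-triangle (suc n) =
  ≡.trans (≡.cong (ℕ._/ 2) (triangle-double n)) (ℕ.m*n/n≡m (triangle (suc n)) 2)

+-triangle-double : ∀ m → + triangle m ℤ.+ + triangle m ≡ + m ℤ.* (+ m ℤ.- + 1)
+-triangle-double zero    = ≡.refl
+-triangle-double (suc m) = ≡.trans
  (≡.trans (lemma (+ triangle (suc m))) (≡.sym (ℤ.pos-* (triangle (suc m)) 2)))
  (≡.trans (≡.cong +_ (≡.sym (triangle-double m))) (ℤ.pos-* (suc m) m))
  where
  lemma : ∀ t → t ℤ.+ t ≡ t ℤ.* + 2
  lemma = solve-∀

binom2-half : ∀ n t → n ℤ.* (n ℤ.- + 1) ≡ + t ℤ.+ + t → binom2 n ≡ + t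
binom2-half n t eq = ≡.trans
  (≡.cong (ℤ._/ℕ 2) (≡.trans eq (≡.cong +_ (double t)))) (≡.cong +_ (ℕ.m*n/n≡m t 2))
  where
  double : ∀ t → t ℕ.+ t ≡ t ℕ.* 2
  double = ℕSolver.solve-∀

binom2-pos : ∀ m → binom2 (+ m) ≡ + triangle m
binom2-pos m = binom2-half (+ m) (triangle m) (≡.sym (+-triangle-double m))

binom2-neg : ∀ m → binom2 (ℤ.- + m) ≡ + triangle (suc m)
binom2-neg m = binom2-half (ℤ.- + m) (triangle (suc m))
  (≡.trans (flip-signs (+ m)) (≡.sym (+-triangle-double (suc m))))
  where
  flip-signs : ∀ n → (ℤ.- n) ℤ.* ((ℤ.- n) ℤ.- + 1) ≡ (+ 1 ℤ.+ n) ℤ.* ((+ 1 ℤ.+ n) ℤ.- + 1)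
  flip-signs = solve-∀

binom2-suc : ∀ n → binom2 (n ℤ.+ + 1) ≡ binom2 n ℤ.+ n
binom2-suc (+ m) = ≡.trans (≡.cong binom2 (≡.cong +_ (ℕ.+-comm m 1)))
  (≡.trans (binom2-pos (suc m))
  (≡.trans (ℤ.+-comm (+ m) (+ triangle m)) (≡.cong (ℤ._+ + m) (≡.sym (binom2-pos m)))))
binom2-suc n@(-[1+ m ]) = ≡.trans (≡.cong binom2 (step m))
  (≡.trans (binom2-neg m)
  (≡.trans (lemma (+ suc m) (+ triangle (suc m))) (≡.cong (ℤ._+ n) (≡.sym (binom2-neg (suc m))))))
  where
  step : ∀ m → -[1+ m ] ℤ.+ + 1 ≡ ℤ.- + m
  step zero    = ≡.refl
  step (suc m) = ≡.refl
  lemma : ∀ n t → t ≡ (n ℤ.+ t) ℤ.+ (ℤ.- n)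
  lemma = solve-∀

binom2-neg-sym : ∀ n → binom2 (ℤ.- n) ≡ binom2 n ℤ.+ n
binom2-neg-sym (+ m) = ≡.trans (binom2-neg m)
  (≡.trans (ℤ.+-comm (+ m) (+ triangle m)) (≡.cong (ℤ._+ + m) (≡.sym (binom2-pos m))))
binom2-neg-sym n@(-[1+ m ]) = ≡.trans (binom2-pos (suc m))
  (≡.trans (lemma (+ suc m) (+ triangle (suc m))) (≡.cong (ℤ._+ n) (≡.sym (binom2-neg (suc m)))))
  where
  lemma : ∀ n t → t ≡ (n ℤ.+ t) ℤ.+ (ℤ.- n)
  lemma = solve-∀

-- The exponent of q in both sums, for paths starting at height z − 1; z = 0 occurs only in
-- the reflection argument for height 0.
expo : ℕ → ℕ → ℤ → ℤ
expo k z n = + k ℤ.* n ℤ.* n ℤ.+ n ℤ.* (+ z ℤ.- + 1) ℤ.- binom2 n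

-- A natural exponent for `_^_`. The absolute value loses nothing when 1 ≤ k and z ≤ k, because
-- `expo` is then nonnegative (`+-expoℕ`).
expoℕ : ℕ → ℕ → ℤ → ℕ
expoℕ k z n = ∣ expo k z n ∣

expo-suc : ∀ k z n → expo k (suc z) n ≡ expo k z n ℤ.+ n
expo-suc k z n = lemma (+ k) (+ z) n (binom2 n)
  where
  lemma : ∀ k z n b → k ℤ.* n ℤ.* n ℤ.+ n ℤ.* ((+ 1 ℤ.+ z) ℤ.- + 1) ℤ.- b
    ≡ (k ℤ.* n ℤ.* n ℤ.+ n ℤ.* (z ℤ.- + 1) ℤ.- b) ℤ.+ n
  lemma = solve-∀

-- At z = 1 the linear term vanishes, and (-n choose 2) = (n choose 2) + n supplies exactly the -n
-- by which z = 0 differs.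
expo-reflect₀ : ∀ k n → expo k 1 (ℤ.- n) ≡ expo k 0 n
expo-reflect₀ k n = ≡.trans
  (≡.cong (λ b → + k ℤ.* (ℤ.- n) ℤ.* (ℤ.- n) ℤ.+ (ℤ.- n) ℤ.* (+ 1 ℤ.- + 1) ℤ.- b) (binom2-neg-sym n))
  (lemma (+ k) n (binom2 n))
  where
  lemma : ∀ k n b → k ℤ.* (ℤ.- n) ℤ.* (ℤ.- n) ℤ.+ (ℤ.- n) ℤ.* (+ 1 ℤ.- + 1) ℤ.- (b ℤ.+ n)
    ≡ k ℤ.* n ℤ.* n ℤ.+ n ℤ.* (+ 0 ℤ.- + 1) ℤ.- b
  lemma = solve-∀

-- At z = k the exponent equals (2k - 1) n(n + 1)/2, which is symmetric under n ↦ -1 - n.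
expo-reflectₖ : ∀ k n → expo k k (ℤ.- (n ℤ.+ + 1)) ≡ expo k k n
expo-reflectₖ k n = ≡.trans
  (≡.cong (λ b → + k ℤ.* n′ ℤ.* n′ ℤ.+ n′ ℤ.* (+ k ℤ.- + 1) ℤ.- b)
    (≡.trans (binom2-neg-sym (n ℤ.+ + 1)) (≡.cong (ℤ._+ (n ℤ.+ + 1)) (binom2-suc n))))
  (lemma (+ k) n (binom2 n))
  where
  n′ = ℤ.- (n ℤ.+ + 1)
  lemma : ∀ k n b →
    k ℤ.* (ℤ.- (n ℤ.+ + 1)) ℤ.* (ℤ.- (n ℤ.+ + 1)) ℤ.+ (ℤ.- (n ℤ.+ + 1)) ℤ.* (k ℤ.- + 1)
      ℤ.- (b ℤ.+ n ℤ.+ (n ℤ.+ + 1))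
    ≡ k ℤ.* n ℤ.* n ℤ.+ n ℤ.* (k ℤ.- + 1) ℤ.- b
  lemma = solve-∀

-- A form without subtraction: one of the `suc k` copies of m² is used up, since m² - m is twice
-- `triangle m` and so covers the subtracted binomial.
expo-pos : ∀ k z m → expo (suc k) z (+ m) ≡ + (k ℕ.* m ℕ.* m ℕ.+ m ℕ.* z ℕ.+ triangle m)
expo-pos k z m = begin
  expo (suc k) z (+ m)
    ≡⟨ ≡.cong (λ b → + suc k ℤ.* + m ℤ.* + m ℤ.+ + m ℤ.* (+ z ℤ.- + 1) ℤ.- b) (binom2-pos m) ⟩
  (+ 1 ℤ.+ + k) ℤ.* + m ℤ.* + m ℤ.+ + m ℤ.* (+ z ℤ.- + 1) ℤ.- + triangle m
    ≡⟨ split (+ k) (+ z) (+ m) (+ triangle m) ⟩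
  + k ℤ.* + m ℤ.* + m ℤ.+ + m ℤ.* + z ℤ.+ (+ m ℤ.* (+ m ℤ.- + 1) ℤ.- + triangle m)
    ≡⟨ ≡.cong (λ d → + k ℤ.* + m ℤ.* + m ℤ.+ + m ℤ.* + z ℤ.+ (d ℤ.- + triangle m)) (+-triangle-double m) ⟨
  + k ℤ.* + m ℤ.* + m ℤ.+ + m ℤ.* + z ℤ.+ ((+ triangle m ℤ.+ + triangle m) ℤ.- + triangle m)
    ≡⟨ cancel (+ k ℤ.* + m ℤ.* + m ℤ.+ + m ℤ.* + z) (+ triangle m) ⟩
  + k ℤ.* + m ℤ.* + m ℤ.+ + m ℤ.* + z ℤ.+ + triangle m
    ≡⟨ ≡.cong (ℤ._+ + triangle m) (≡.cong₂ ℤ._+_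
         (≡.trans (≡.cong (ℤ._* + m) (≡.sym (ℤ.pos-* k m))) (≡.sym (ℤ.pos-* (k ℕ.* m) m)))
         (≡.sym (ℤ.pos-* m z))) ⟩
  + (k ℕ.* m ℕ.* m ℕ.+ m ℕ.* z ℕ.+ triangle m) ∎
  where
  open ≡.≡-Reasoning
  split : ∀ k z m t → (+ 1 ℤ.+ k) ℤ.* m ℤ.* m ℤ.+ m ℤ.* (z ℤ.- + 1) ℤ.- t
    ≡ k ℤ.* m ℤ.* m ℤ.+ m ℤ.* z ℤ.+ (m ℤ.* (m ℤ.- + 1) ℤ.- t)
  split = solve-∀
  cancel : ∀ a t → a ℤ.+ ((t ℤ.+ t) ℤ.- t) ≡ a ℤ.+ t
  cancel = solve-∀

-- For negative n the term n(z - 1) is negative. The slack y = suc k - z shows that it is still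
-- dominated by the quadratic term; this is where z ≤ k enters `+-expoℕ`.
expo-neg : ∀ k z y m → suc k ≡ z ℕ.+ y →
  expo (suc k) z (ℤ.- + m) ≡ + (k ℕ.* (triangle m ℕ.+ triangle m) ℕ.+ m ℕ.* y ℕ.+ triangle m)
expo-neg k z y m eq = begin
  expo (suc k) z (ℤ.- + m)
    ≡⟨ ≡.cong (λ b → (+ 1 ℤ.+ + k) ℤ.* (ℤ.- + m) ℤ.* (ℤ.- + m) ℤ.+ (ℤ.- + m) ℤ.* (+ z ℤ.- + 1) ℤ.- b)
         (binom2-neg m) ⟩
  (+ 1 ℤ.+ + k) ℤ.* (ℤ.- + m) ℤ.* (ℤ.- + m) ℤ.+ (ℤ.- + m) ℤ.* (+ z ℤ.- + 1) ℤ.- (+ m ℤ.+ τ)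
    ≡⟨ ≡.cong (λ z → (+ 1 ℤ.+ + k) ℤ.* (ℤ.- + m) ℤ.* (ℤ.- + m) ℤ.+ (ℤ.- + m) ℤ.* (z ℤ.- + 1)
         ℤ.- (+ m ℤ.+ τ)) z≡ ⟩
  (+ 1 ℤ.+ + k) ℤ.* (ℤ.- + m) ℤ.* (ℤ.- + m) ℤ.+ (ℤ.- + m) ℤ.* (+ 1 ℤ.+ + k ℤ.- + y ℤ.- + 1)
      ℤ.- (+ m ℤ.+ τ)
    ≡⟨ split (+ k) (+ y) (+ m) τ ⟩
  + k ℤ.* (+ m ℤ.* (+ m ℤ.- + 1)) ℤ.+ + m ℤ.* + y ℤ.+ (+ m ℤ.* (+ m ℤ.- + 1) ℤ.- τ)
    ≡⟨ ≡.cong (λ d → + k ℤ.* d ℤ.+ + m ℤ.* + y ℤ.+ (d ℤ.- τ)) (+-triangle-double m) ⟨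
  + k ℤ.* (τ ℤ.+ τ) ℤ.+ + m ℤ.* + y ℤ.+ ((τ ℤ.+ τ) ℤ.- τ)
    ≡⟨ cancel (+ k ℤ.* (τ ℤ.+ τ) ℤ.+ + m ℤ.* + y) τ ⟩
  + k ℤ.* + (triangle m ℕ.+ triangle m) ℤ.+ + m ℤ.* + y ℤ.+ τ
    ≡⟨ ≡.cong (ℤ._+ τ) (≡.cong₂ ℤ._+_ (≡.sym (ℤ.pos-* k _)) (≡.sym (ℤ.pos-* m y))) ⟩
  + (k ℕ.* (triangle m ℕ.+ triangle m) ℕ.+ m ℕ.* y ℕ.+ triangle m) ∎
  where
  open ≡.≡-Reasoning
  τ = + triangle m
  add-sub : ∀ z y → z ≡ (z ℤ.+ y) ℤ.- y
  add-sub = solve-∀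
  z≡ : + z ≡ + 1 ℤ.+ + k ℤ.- + y
  z≡ = ≡.trans (add-sub (+ z) (+ y)) (≡.cong (λ s → + s ℤ.- + y) (≡.sym eq))
  split : ∀ k y m t →
    (+ 1 ℤ.+ k) ℤ.* (ℤ.- m) ℤ.* (ℤ.- m) ℤ.+ (ℤ.- m) ℤ.* (+ 1 ℤ.+ k ℤ.- y ℤ.- + 1) ℤ.- (m ℤ.+ t)
    ≡ k ℤ.* (m ℤ.* (m ℤ.- + 1)) ℤ.+ m ℤ.* y ℤ.+ (m ℤ.* (m ℤ.- + 1) ℤ.- t)
  split = solve-∀
  cancel : ∀ a t → a ℤ.+ ((t ℤ.+ t) ℤ.- t) ≡ a ℤ.+ t
  cancel = solve-∀

+-expoℕ : ∀ {k z} n → 1 ℕ.≤ k → z ℕ.≤ k → + expoℕ k z n ≡ expo k z n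
+-expoℕ {suc k} {z} (+ m) (s≤s z≤n) z≤k rewrite expo-pos k z m = ≡.refl
+-expoℕ {suc k} {z} (-[1+ m ]) (s≤s z≤n) z≤k
  rewrite expo-neg k z (suc k ℕ.∸ z) (suc m) (≡.sym (ℕ.m+[n∸m]≡n z≤k)) = ≡.refl

n+n≡2*n : ∀ n → n ℕ.+ n ≡ 2 ℕ.* n
n+n≡2*n = ℕSolver.solve-∀

2*-suc : ∀ n → 2 ℕ.* suc n ≡ suc (suc (2 ℕ.* n))
2*-suc n = lemma n
  where
  lemma : ∀ n → 2 ℕ.* (1 ℕ.+ n) ≡ 2 ℕ.+ 2 ℕ.* n
  lemma = ℕSolver.solve-∀

t+u-t≡u : ∀ t u → (t ℤ.+ u) ℤ.- t ≡ u
t+u-t≡u = solve-∀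

-- Reindexing by t = N + n, the subscript of one Pochhammer factor. The other subscript is u: N - n
-- on t + u = 2N, and N - n - 1 on t + u = 2N - 1.
index : ℕ → ℕ → ℤ
index N t = + t ℤ.- + N

N-index≡u : ∀ N t u → t ℕ.+ u ≡ 2 ℕ.* N → + N ℤ.- index N t ≡ + u
N-index≡u N t u eq = ≡.trans (lemma (+ N) (+ t))
  (≡.trans (≡.cong (λ s → + s ℤ.- + t) (≡.trans (n+n≡2*n N) (≡.sym eq))) (t+u-t≡u (+ t) (+ u)))
  where
  lemma : ∀ N t → N ℤ.- (t ℤ.- N) ≡ (N ℤ.+ N) ℤ.- t
  lemma = solve-∀

N-index-1≡u : ∀ M t u → t ℕ.+ u ≡ suc (2 ℕ.* M) → + suc M ℤ.- index (suc M) t ℤ.- + 1 ≡ + u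
N-index-1≡u M t u eq = ≡.trans
  (≡.cong (ℤ._- + 1) (N-index≡u (suc M) t (suc u)
    (≡.trans (ℕ.+-suc t u) (≡.trans (≡.cong suc eq) (≡.sym (2*-suc M))))))
  (t+u-t≡u (+ 1) (+ u))

N+index≡t : ∀ N t → + N ℤ.+ index N t ≡ + t
N+index≡t N t = lemma (+ N) (+ t)
  where
  lemma : ∀ N t → N ℤ.+ (t ℤ.- N) ≡ t
  lemma = solve-∀

-- Allows the sign (-1)^|n| to be read as (-1)^(t + N), with no absolute value.
∣index∣-parity : ∀ N t → ∃ λ c → t ℕ.+ N ≡ ∣ index N t ∣ ℕ.+ 2 ℕ.* c
∣index∣-parity N t with ℕ.≤-total t N
... | inj₁ t≤N with ℕ.m≤n⇒∃[o]m+o≡n t≤N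
...   | d , ≡.refl = t , ≡.trans (total t d)
  (≡.cong (ℕ._+ 2 ℕ.* t) (≡.sym (≡.trans (≡.cong ∣_∣ (diff (+ t) (+ d))) (ℤ.∣-i∣≡∣i∣ (+ d)))))
  where
  diff : ∀ t d → t ℤ.- (t ℤ.+ d) ≡ ℤ.- d
  diff = solve-∀
  total : ∀ t d → t ℕ.+ (t ℕ.+ d) ≡ d ℕ.+ 2 ℕ.* t
  total = ℕSolver.solve-∀
∣index∣-parity N t | inj₂ N≤t with ℕ.m≤n⇒∃[o]m+o≡n N≤t
...   | d , ≡.refl = N , ≡.trans (total N d)
  (≡.cong (ℕ._+ 2 ℕ.* N) (≡.sym (≡.cong ∣_∣ (diff (+ N) (+ d)))))
  where
  diff : ∀ N d → (N ℤ.+ d) ℤ.- N ≡ d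
  diff = solve-∀
  total : ∀ N d → N ℕ.+ d ℕ.+ N ≡ d ℕ.+ 2 ℕ.* N
  total = ℕSolver.solve-∀

module Exponents {k : ℕ} (1≤k : 1 ℕ.≤ k) where

  -- N = n + (N - n): the summand n raises z by one, and N - n = u is the power of q that `I-suc`
  -- produces at u.
  expoℕ-raiseᵘ : ∀ {z} N t u → suc z ℕ.≤ k → t ℕ.+ u ≡ 2 ℕ.* N →
    N ℕ.+ expoℕ k z (index N t) ≡ expoℕ k (suc z) (index N t) ℕ.+ u
  expoℕ-raiseᵘ {z} N t u z<k eq = ℤ.+-injective (begin
    + N ℤ.+ + expoℕ k z n          ≡⟨ ≡.cong (λ x → + N ℤ.+ x) (+-expoℕ n 1≤k (ℕ.<⇒≤ z<k)) ⟩
    + N ℤ.+ expo k z n             ≡⟨ lemma (+ N) n (expo k z n) ⟩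
    expo k z n ℤ.+ n ℤ.+ (+ N ℤ.- n)
      ≡⟨ ≡.cong₂ ℤ._+_ (≡.sym (expo-suc k z n)) (N-index≡u N t u eq) ⟩
    expo k (suc z) n ℤ.+ + u       ≡⟨ ≡.cong (ℤ._+ + u) (+-expoℕ n 1≤k z<k) ⟨
    + expoℕ k (suc z) n ℤ.+ + u    ∎)
    where
    open ≡.≡-Reasoning
    n = index N t
    lemma : ∀ N n x → N ℤ.+ x ≡ x ℤ.+ n ℤ.+ (N ℤ.- n)
    lemma = solve-∀

  -- The mirror image: lowering z by one leaves n, and N + n = t.
  expoℕ-raiseᵗ : ∀ {z} N t → suc z ℕ.≤ k →
    N ℕ.+ expoℕ k (suc z) (index N t) ≡ expoℕ k z (index N t) ℕ.+ t
  expoℕ-raiseᵗ {z} N t z<k = ℤ.+-injective (begin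
    + N ℤ.+ + expoℕ k (suc z) n    ≡⟨ ≡.cong (λ x → + N ℤ.+ x) (+-expoℕ n 1≤k z<k) ⟩
    + N ℤ.+ expo k (suc z) n       ≡⟨ ≡.cong (λ x → + N ℤ.+ x) (expo-suc k z n) ⟩
    + N ℤ.+ (expo k z n ℤ.+ n)     ≡⟨ lemma (+ N) n (expo k z n) ⟩
    expo k z n ℤ.+ (+ N ℤ.+ n)
      ≡⟨ ≡.cong₂ ℤ._+_ (≡.sym (+-expoℕ n 1≤k (ℕ.<⇒≤ z<k))) (N+index≡t N t) ⟩
    + expoℕ k z n ℤ.+ + t          ∎)
    where
    open ≡.≡-Reasoning
    n = index N t
    lemma : ∀ N n x → N ℤ.+ (x ℤ.+ n) ≡ x ℤ.+ (N ℤ.+ n)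
    lemma = solve-∀

  expoℕ-reflect₀ : ∀ N t u → t ℕ.+ u ≡ 2 ℕ.* N → expoℕ k 0 (index N t) ≡ expoℕ k 1 (index N u)
  expoℕ-reflect₀ N t u eq = ≡.cong ∣_∣ (≡.trans (≡.sym (expo-reflect₀ k (index N t)))
    (≡.cong (expo k 1) (≡.trans (lemma (+ N) (index N t)) (≡.cong (ℤ._- + N) (N-index≡u N t u eq)))))
    where
    lemma : ∀ N n → ℤ.- n ≡ (N ℤ.- n) ℤ.- N
    lemma = solve-∀

  expoℕ-reflectₖ : ∀ M t u → t ℕ.+ u ≡ suc (2 ℕ.* M) →
    expoℕ k k (index (suc M) t) ≡ expoℕ k k (index (suc M) u)
  expoℕ-reflectₖ M t u eq = ≡.cong ∣_∣ (≡.trans (≡.sym (expo-reflectₖ k (index (suc M) t)))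
    (≡.cong (expo k k) (≡.trans (lemma (+ suc M) (index (suc M) t))
      (≡.cong (ℤ._- + suc M) (N-index-1≡u M t u eq)))))
    where
    lemma : ∀ N n → ℤ.- (n ℤ.+ + 1) ≡ (N ℤ.- n ℤ.- + 1) ℤ.- N
    lemma = solve-∀

-- The recurrences for the closed forms, over any commutative ring.

-- I n stands for 1/(q)_n and P n for aⁿ (−1/a)_n.
record QPochhammer {c ℓ} (R : CommutativeRing c ℓ) : Set (c ⊔ ℓ) where
  open CommutativeRing R
  open Exp semiring
  field
    q a   : Carrier
    I P   : ℕ → Carrier
    I-suc : ∀ n → I (suc n) ≈ I n + q ^ suc n * I (suc n)
    P-suc : ∀ n → P (suc n) ≈ (a + q ^ n) * P n

module QSeries {c ℓ} {R : CommutativeRing c ℓ} (D : QPochhammer R) {k : ℕ} (1≤k : 1 ℕ.≤ k) where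

  open CommutativeRing R
  open Exp semiring
  open QPochhammer D
  open AntidiagonalSums R
  open Exponents 1≤k
  open RingProperties ring using (-‿distribˡ-*; -‿involutive)
  open SemiringSolver commutativeSemiring
  open SetoidReasoning setoid

  sgn : ℕ → Carrier
  sgn zero    = 1#
  sgn (suc n) = - sgn n

  sgn-+2* : ∀ n m → sgn (n ℕ.+ 2 ℕ.* m) ≈ sgn n
  sgn-+2* n zero    = reflexive (≡.cong sgn (ℕ.+-identityʳ n))
  sgn-+2* n (suc m) = begin
    sgn (n ℕ.+ 2 ℕ.* suc m)             ≡⟨ ≡.cong sgn (lemma n m) ⟩
    - - sgn (n ℕ.+ 2 ℕ.* m)             ≈⟨ -‿involutive _ ⟩
    sgn (n ℕ.+ 2 ℕ.* m)                 ≈⟨ sgn-+2* n m ⟩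
    sgn n                               ∎
    where
    lemma : ∀ n m → n ℕ.+ 2 ℕ.* (1 ℕ.+ m) ≡ 2 ℕ.+ (n ℕ.+ 2 ℕ.* m)
    lemma = ℕSolver.solve-∀

  sgn-index : ∀ N t → sgn ∣ index N t ∣ ≈ sgn (t ℕ.+ N)
  sgn-index N t = let c , eq = ∣index∣-parity N t in
    trans (sym (sgn-+2* ∣ index N t ∣ c)) (reflexive (≡.cong sgn (≡.sym eq)))

  sgn-swap-even : ∀ N M t u → t ℕ.+ u ≡ 2 ℕ.* M → sgn (t ℕ.+ N) ≈ sgn (u ℕ.+ N)
  sgn-swap-even N M t u eq = begin
    sgn (t ℕ.+ N)                ≈⟨ sgn-+2* (t ℕ.+ N) u ⟨
    sgn (t ℕ.+ N ℕ.+ 2 ℕ.* u)    ≡⟨ ≡.cong sgn (lemma t u N) ⟩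
    sgn (u ℕ.+ N ℕ.+ (t ℕ.+ u))  ≡⟨ ≡.cong (λ s → sgn (u ℕ.+ N ℕ.+ s)) eq ⟩
    sgn (u ℕ.+ N ℕ.+ 2 ℕ.* M)    ≈⟨ sgn-+2* (u ℕ.+ N) M ⟩
    sgn (u ℕ.+ N)                ∎
    where
    lemma : ∀ t u N → t ℕ.+ N ℕ.+ 2 ℕ.* u ≡ u ℕ.+ N ℕ.+ (t ℕ.+ u)
    lemma = ℕSolver.solve-∀

  sgn-swap-odd : ∀ N M t u → t ℕ.+ u ≡ suc (2 ℕ.* M) → sgn (t ℕ.+ N) ≈ - sgn (u ℕ.+ N)
  -- Replacing u by `suc u` makes the total even, and the sign there is by definition the negative
  -- of the wanted one.
  sgn-swap-odd N M t u eq = sgn-swap-even N (suc M) t (suc u)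
    (≡.trans (ℕ.+-suc t u) (≡.trans (≡.cong suc eq) (≡.sym (2*-suc M))))

  -- One formula for both families: on t + u = 2N it is the summand of E, and on t + u = 2N - 1 that
  -- of Γ.
  term : ℕ → ℕ → ℕ → ℕ → Carrier
  term z N t u = sgn (t ℕ.+ N) * (q ^ expoℕ k z (index N t) * (I u * I t))

  eSum : ℕ → ℕ → Carrier
  eSum z N = Σᵈ (2 ℕ.* N) (term z N)

  -- For N = 0 the range -N ≤ n ≤ N - 1 is empty; for N = M + 1 its 2M + 2 indices are the pairs
  -- with t + u = 2M + 1.
  gSum : ℕ → ℕ → Carrier
  gSum z zero    = 0#
  gSum z (suc M) = Σᵈ (suc (2 ℕ.* M)) (term z (suc M))

  q^-shift : ∀ a b c d → a ℕ.+ b ≡ c ℕ.+ d → q ^ a * q ^ b ≈ q ^ c * q ^ d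
  q^-shift a b c d eq = begin
    q ^ a * q ^ b    ≈⟨ ^-homo-* q a b ⟨
    q ^ (a ℕ.+ b)    ≡⟨ ≡.cong (q ^_) eq ⟩
    q ^ (c ℕ.+ d)    ≈⟨ ^-homo-* q c d ⟩
    q ^ c * q ^ d    ∎

  pull-out : ∀ s x Q y → s * (x * Q * y) ≈ x * (s * (Q * y))
  pull-out = solve 4 (λ s x Q y → s :* (x :* Q :* y) := x :* (s :* (Q :* y))) refl

  -- `I-suc` splits 1/(q)_{u+1}. In one part q^(u+1) turns the exponent for z + 1 into N plus that
  -- for z; the other part, with u in place of u + 1, is a summand of Γ.
  term-raiseᵘ : ∀ {z} N t u → suc z ℕ.≤ k → t ℕ.+ suc u ≡ 2 ℕ.* N →
    term (suc z) N t (suc u) ≈ q ^ N * term z N t (suc u) + term (suc z) N t u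
  term-raiseᵘ {z} N t u z<k eq = begin
    s * (Q′ * (I (suc u) * I t))
      ≈⟨ *-congˡ (*-congˡ (*-congʳ (I-suc u))) ⟩
    s * (Q′ * ((I u + q ^ suc u * I (suc u)) * I t))
      ≈⟨ solve 6 (λ s Q′ y qu y′ x → s :* (Q′ :* ((y :+ qu :* y′) :* x))
                  := s :* (Q′ :* qu :* (y′ :* x)) :+ s :* (Q′ :* (y :* x))) refl
           s Q′ (I u) (q ^ suc u) (I (suc u)) (I t) ⟩
    s * (Q′ * q ^ suc u * (I (suc u) * I t)) + s * (Q′ * (I u * I t))
      ≈⟨ +-congʳ (*-congˡ (*-congʳ (q^-shift N X X′ (suc u) (expoℕ-raiseᵘ N t (suc u) z<k eq)))) ⟨
    s * (q ^ N * Q * (I (suc u) * I t)) + s * (Q′ * (I u * I t))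
      ≈⟨ +-congʳ (pull-out s (q ^ N) Q (I (suc u) * I t)) ⟩
    q ^ N * (s * (Q * (I (suc u) * I t))) + s * (Q′ * (I u * I t)) ∎
    where
    s = sgn (t ℕ.+ N)
    X = expoℕ k z (index N t)
    X′ = expoℕ k (suc z) (index N t)
    Q = q ^ X
    Q′ = q ^ X′

  term-raiseᵘ₀ : ∀ {z} N t → suc z ℕ.≤ k → t ≡ 2 ℕ.* N → term (suc z) N t 0 ≈ q ^ N * term z N t 0
  term-raiseᵘ₀ {z} N t z<k eq = begin
    s * (Q′ * y)          ≈⟨ *-congˡ (*-congʳ (*-identityʳ Q′)) ⟨
    s * (Q′ * 1# * y)
      ≈⟨ *-congˡ (*-congʳ (q^-shift N X X′ 0
           (expoℕ-raiseᵘ N t 0 z<k (≡.trans (ℕ.+-identityʳ t) eq)))) ⟨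
    s * (q ^ N * Q * y)   ≈⟨ pull-out s (q ^ N) Q y ⟩
    q ^ N * (s * (Q * y)) ∎
    where
    s = sgn (t ℕ.+ N)
    y = I 0 * I t
    X = expoℕ k z (index N t)
    X′ = expoℕ k (suc z) (index N t)
    Q = q ^ X
    Q′ = q ^ X′

  eSum-suc : ∀ {z} N → suc z ℕ.≤ k → eSum (suc z) N ≈ q ^ N * eSum z N + gSum (suc z) N
  eSum-suc {z} zero z<k = trans (term-raiseᵘ₀ 0 0 z<k ≡.refl) (sym (+-identityʳ _))
  eSum-suc {z} (suc M) z<k = begin
    Σᵈ (2 ℕ.* N) (term (suc z) N)
      ≡⟨ ≡.cong (λ L → Σᵈ L (term (suc z) N)) (2*-suc M) ⟩
    Σᵈ (suc L) (term (suc z) N)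
      -- The isolated term u = 0 is n = N, the one index of E outside the range of Γ.
      ≈⟨ Σᵈ-last L (term (suc z) N) ⟩
    term (suc z) N (suc L) 0 + Σᵈ L (λ t u → term (suc z) N t (suc u))
      ≈⟨ +-cong (term-raiseᵘ₀ N (suc L) z<k (≡.sym (2*-suc M)))
           (Σᵈ-cong L λ t u eq → term-raiseᵘ N t u z<k
             (≡.trans (ℕ.+-suc t u) (≡.trans (≡.cong suc eq) (≡.sym (2*-suc M))))) ⟩
    q ^ N * term z N (suc L) 0 + Σᵈ L (λ t u → q ^ N * term z N t (suc u) + term (suc z) N t u)
      ≈⟨ +-congˡ (trans (Σᵈ-+ L (λ t u → q ^ N * term z N t (suc u)) (term (suc z) N))
           (+-congʳ (Σᵈ-*ˡ L (q ^ N) (λ t u → term z N t (suc u))))) ⟩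
    q ^ N * term z N (suc L) 0 + (q ^ N * Σᵈ L (λ t u → term z N t (suc u)) + gSum (suc z) N)
      ≈⟨ +-assoc _ _ _ ⟨
    q ^ N * term z N (suc L) 0 + q ^ N * Σᵈ L (λ t u → term z N t (suc u)) + gSum (suc z) N
      ≈⟨ +-congʳ (distribˡ _ _ _) ⟨
    q ^ N * (term z N (suc L) 0 + Σᵈ L (λ t u → term z N t (suc u))) + gSum (suc z) N
      ≈⟨ +-congʳ (*-congˡ (Σᵈ-last L (term z N))) ⟨
    q ^ N * Σᵈ (suc L) (term z N) + gSum (suc z) N
      ≡⟨ ≡.cong (λ L → q ^ N * Σᵈ L (term z N) + gSum (suc z) N) (2*-suc M) ⟨
    q ^ N * eSum z N + gSum (suc z) N ∎
    where
    N = suc M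
    L = suc (2 ℕ.* M)

  -- Here 1/(q)_{t+1} is split. Lowering t and N together leaves n = t - N and the sign unchanged,
  -- so the second part is a summand of E with one peak fewer.
  term-raiseᵗ : ∀ {z} M t u → suc z ℕ.≤ k →
    term z (suc M) (suc t) u ≈ q ^ suc M * term (suc z) (suc M) (suc t) u + term z M t u
  term-raiseᵗ {z} M t u z<k = begin
    s * (Q * (I u * I (suc t)))
      ≈⟨ *-congˡ (*-congˡ (*-congˡ (I-suc t))) ⟩
    s * (Q * (I u * (I t + q ^ suc t * I (suc t))))
      ≈⟨ solve 6 (λ s Q y x qt x′ → s :* (Q :* (y :* (x :+ qt :* x′)))
                  := s :* (Q :* qt :* (y :* x′)) :+ s :* (Q :* (y :* x))) refl
           s Q (I u) (I t) (q ^ suc t) (I (suc t)) ⟩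
    s * (Q * q ^ suc t * (I u * I (suc t))) + s * (Q * (I u * I t))
      ≈⟨ +-cong (*-congˡ (*-congʳ (sym (q^-shift N X′ X (suc t) (expoℕ-raiseᵗ N (suc t) z<k)))))
           (*-cong s≈ (*-congʳ (reflexive (≡.cong (λ n → q ^ expoℕ k z n) index-suc)))) ⟩
    s * (q ^ N * Q′ * (I u * I (suc t))) + term z M t u
      ≈⟨ +-congʳ (pull-out s (q ^ N) Q′ (I u * I (suc t))) ⟩
    q ^ N * (s * (Q′ * (I u * I (suc t)))) + term z M t u ∎
    where
    N = suc M
    s = sgn (suc t ℕ.+ N)
    X = expoℕ k z (index N (suc t))
    X′ = expoℕ k (suc z) (index N (suc t))
    Q = q ^ X
    Q′ = q ^ X′
    s≈ : s ≈ sgn (t ℕ.+ M)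
    s≈ = trans (reflexive (≡.cong (λ n → - sgn n) (ℕ.+-suc t M))) (-‿involutive _)
    index-suc : index N (suc t) ≡ index M t
    index-suc = lemma (+ t) (+ M)
      where
      lemma : ∀ t M → (+ 1 ℤ.+ t) ℤ.- (+ 1 ℤ.+ M) ≡ t ℤ.- M
      lemma = solve-∀

  -- The term n = -N, which has no counterpart in the sum for N - 1; as t = 0, the exponents differ
  -- by exactly N.
  term-raiseᵗ₀ : ∀ {z} N u → suc z ℕ.≤ k → term z N 0 u ≈ q ^ N * term (suc z) N 0 u
  term-raiseᵗ₀ {z} N u z<k = begin
    s * (Q * y)            ≈⟨ *-congˡ (*-congʳ (*-identityʳ Q)) ⟨
    s * (Q * 1# * y)       ≈⟨ *-congˡ (*-congʳ (q^-shift N X′ X 0 (expoℕ-raiseᵗ N 0 z<k))) ⟨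
    s * (q ^ N * Q′ * y)   ≈⟨ pull-out s (q ^ N) Q′ y ⟩
    q ^ N * (s * (Q′ * y)) ∎
    where
    s = sgn N
    y = I u * I 0
    X = expoℕ k z (index N 0)
    X′ = expoℕ k (suc z) (index N 0)
    Q = q ^ X
    Q′ = q ^ X′

  gSum-suc : ∀ {z} M → suc z ℕ.≤ k → gSum z (suc M) ≈ q ^ suc M * gSum (suc z) (suc M) + eSum z M
  gSum-suc {z} M z<k = begin
    term z N 0 (suc L) + Σᵈ L (term z N ∘ suc)
      ≈⟨ +-cong (term-raiseᵗ₀ N (suc L) z<k) (Σᵈ-cong L λ t u _ → term-raiseᵗ M t u z<k) ⟩
    q ^ N * term (suc z) N 0 (suc L) + Σᵈ L (λ t u → q ^ N * term (suc z) N (suc t) u + term z M t u)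
      ≈⟨ +-congˡ (trans (Σᵈ-+ L _ _) (+-congʳ (Σᵈ-*ˡ L _ _))) ⟩
    q ^ N * term (suc z) N 0 (suc L) + (q ^ N * Σᵈ L (term (suc z) N ∘ suc) + eSum z M)
      ≈⟨ +-assoc _ _ _ ⟨
    q ^ N * term (suc z) N 0 (suc L) + q ^ N * Σᵈ L (term (suc z) N ∘ suc) + eSum z M
      ≈⟨ +-congʳ (distribˡ _ _ _) ⟨
    q ^ N * gSum (suc z) N + eSum z M ∎
    where
    N = suc M
    L = 2 ℕ.* M

  -- Reversing the summation (n ↦ −n) identifies the sums for heights −1 and 0.
  eSum-reflect : ∀ N → eSum 0 N ≈ eSum 1 N
  eSum-reflect N = begin
    Σᵈ (2 ℕ.* N) (term 0 N)
      ≈⟨ Σᵈ-cong (2 ℕ.* N) (λ t u eq → *-cong (sgn-swap-even N N t u eq)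
           (*-cong (reflexive (≡.cong (q ^_) (expoℕ-reflect₀ N t u eq))) (*-comm _ _))) ⟩
    Σᵈ (2 ℕ.* N) (flip (term 1 N))
      ≈⟨ Σᵈ-swap (2 ℕ.* N) _ ⟨
    eSum 1 N ∎

  -- n ↦ −1 − n changes the sign of every term when the starting height is k − 1.
  gSum-antisym : ∀ N → gSum k N + gSum k N ≈ 0#
  gSum-antisym zero    = +-identityˡ _
  gSum-antisym (suc M) = begin
    gSum k N + gSum k N
      ≈⟨ +-congˡ (Σᵈ-swap L (term k N)) ⟩
    Σᵈ L (term k N) + Σᵈ L (flip (term k N))
      ≈⟨ Σᵈ-+ L (term k N) (flip (term k N)) ⟨
    Σᵈ L (λ t u → term k N t u + term k N u t)
      ≈⟨ Σᵈ-cong L cancel ⟩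
    Σᵈ L (λ _ _ → 0#)
      ≈⟨ Σᵈ-zero L ⟩
    0# ∎
    where
    N = suc M
    L = suc (2 ℕ.* M)
    cancel : ∀ t u → t ℕ.+ u ≡ L → term k N t u + term k N u t ≈ 0#
    cancel t u eq = begin
      term k N t u + term k N u t
        ≈⟨ +-congʳ (*-cong (sgn-swap-odd N M t u eq)
             (*-cong (reflexive (≡.cong (q ^_) (expoℕ-reflectₖ M t u eq))) (*-comm _ _))) ⟩
      - sgn (u ℕ.+ N) * y + term k N u t
        ≈⟨ +-congʳ (-‿distribˡ-* _ _) ⟨
      - term k N u t + term k N u t
        ≈⟨ -‿inverseˡ _ ⟩
      0# ∎
      where
      y = q ^ expoℕ k k (index N u) * (I t * I u)

  eSeries : ℕ → ℕ → Carrier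
  eSeries z N = q ^ triangle (suc N) * P N * eSum z N

  gSeries : ℕ → ℕ → Carrier
  gSeries z N = q ^ triangle N * P N * gSum z N

  -- `z′` is left free so that the computation serves both z′ = z - 1 and, at height 0, z′ = z = 1.
  -- The factor q^N on `gSeries` is the quotient of the two prefactors.
  eSeries-step : ∀ z z′ N → eSum z N ≈ q ^ N * eSum z′ N + gSum z N →
    eSeries z N ≈ q ^ N * eSeries z′ N + q ^ N * gSeries z N
  eSeries-step z z′ N eq = begin
    q ^ (N ℕ.+ triangle N) * P N * eSum z N
      ≈⟨ *-cong (*-congʳ (^-homo-* q N (triangle N))) eq ⟩
    q ^ N * q ^ triangle N * P N * (q ^ N * eSum z′ N + gSum z N)
      ≈⟨ solve 5 (λ qN qt p e g → qN :* qt :* p :* (qN :* e :+ g)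
                  := qN :* (qN :* qt :* p :* e) :+ qN :* (qt :* p :* g)) refl
           (q ^ N) (q ^ triangle N) (P N) (eSum z′ N) (gSum z N) ⟩
    q ^ N * (q ^ N * q ^ triangle N * P N * eSum z′ N) + q ^ N * gSeries z N
      ≈⟨ +-congʳ (*-congˡ (*-congʳ (*-congʳ (^-homo-* q N (triangle N))))) ⟨
    q ^ N * eSeries z′ N + q ^ N * gSeries z N ∎

  eSeries-suc : ∀ {z} N → suc z ℕ.≤ k →
    eSeries (suc z) N ≈ q ^ N * eSeries z N + q ^ N * gSeries (suc z) N
  eSeries-suc {z} N z<k = eSeries-step (suc z) z N (eSum-suc N z<k)

  -- The step from height -1 to height 0, with the sum at height -1 replaced by its reflection at
  -- height 0. It matches the removal of an `E` step.
  eSeries-one : ∀ N → eSeries 1 N ≈ q ^ N * eSeries 1 N + q ^ N * gSeries 1 N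
  eSeries-one N = eSeries-step 1 1 N (trans (eSum-suc N 1≤k) (+-congʳ (*-congˡ (eSum-reflect N))))

  -- The factor a + q^M is the one that `P` gains from M to M + 1. The power of q needs no change,
  -- as `gSeries` at M + 1 and `eSeries` at M both carry `triangle (suc M)`.
  gSeries-suc : ∀ {z} M → suc z ℕ.≤ k →
    gSeries z (suc M)
      ≈ q ^ suc M * gSeries (suc z) (suc M) + (a * eSeries z M + q ^ M * eSeries z M)
  gSeries-suc {z} M z<k = begin
    q ^ triangle (suc M) * P (suc M) * gSum z (suc M)
      ≈⟨ *-congˡ (gSum-suc M z<k) ⟩
    q ^ triangle (suc M) * P (suc M) * (q ^ suc M * gSum (suc z) (suc M) + eSum z M)
      ≈⟨ solve 5 (λ qt p qN g e → qt :* p :* (qN :* g :+ e)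
                  := qN :* (qt :* p :* g) :+ qt :* p :* e) refl
           (q ^ triangle (suc M)) (P (suc M)) (q ^ suc M) (gSum (suc z) (suc M)) (eSum z M) ⟩
    q ^ suc M * gSeries (suc z) (suc M) + q ^ triangle (suc M) * P (suc M) * eSum z M
      ≈⟨ +-congˡ (*-congʳ (*-congˡ (P-suc M))) ⟩
    q ^ suc M * gSeries (suc z) (suc M) + q ^ triangle (suc M) * ((a + q ^ M) * P M) * eSum z M
      ≈⟨ +-congˡ (solve 5 (λ qt a qM p e → qt :* ((a :+ qM) :* p) :* e
                            := a :* (qt :* p :* e) :+ qM :* (qt :* p :* e)) refl
           (q ^ triangle (suc M)) a (q ^ M) (P M) (eSum z M)) ⟩
    q ^ suc M * gSeries (suc z) (suc M) + (a * eSeries z M + q ^ M * eSeries z M) ∎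

  gSeries-antisym : ∀ N → gSeries k N + gSeries k N ≈ 0#
  gSeries-antisym N = trans (sym (distribˡ _ _ _)) (trans (*-congˡ (gSum-antisym N)) (zeroʳ _))

  gSeries-zero : ∀ z → gSeries z 0 ≈ 0#
  gSeries-zero z = zeroʳ _

-- Counting sets of paths by complete enumerations.

module ⇔ = Equivalence

-- The condition that `GenFunIs` imposes at a single coefficient, for an arbitrary set of paths.
Count : (Path → Set) → ℤ → Set
Count F c = Σ (List Path) λ ls → Unique ls × (∀ P → (P ∈ ls) ⇔ F P) × (+ length ls ≡ c)

count-cong : ∀ {F G c d} → (∀ P → F P ⇔ G P) → c ≡ d → Count F c → Count G d
count-cong F⇔G ≡.refl (ls , uniq , mem , len) =
  ls , uniq , (λ P → mk⇔ (⇔.to (F⇔G P) ∘ ⇔.to (mem P)) (⇔.from (mem P) ∘ ⇔.from (F⇔G P))) , len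

count-∅ : ∀ {F} → (∀ P → ¬ F P) → Count F (+ 0)
count-∅ ¬F = [] , [] , (λ P → mk⇔ (λ ()) (⊥-elim ∘ ¬F P)) , ≡.refl

count-singleton : ∀ P₀ → Count (_≡ P₀) (+ 1)
count-singleton P₀ = P₀ ∷ [] , [] ∷ [] , (λ P → mk⇔ (λ { (here eq) → eq ; (there ()) }) here) , ≡.refl

count-⊎ : ∀ {F G c d} → (∀ P → F P → ¬ G P) → Count F c → Count G d →
  Count (λ P → F P ⊎ G P) (c ℤ.+ d)
count-⊎ {F} {G} disj (ls , uniq , mem , ≡.refl) (ls′ , uniq′ , mem′ , ≡.refl) =
  ls ++ ls′ ,
  Unique.++⁺ uniq uniq′ (λ { (p , p′) → disj _ (⇔.to (mem _) p) (⇔.to (mem′ _) p′) }) ,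
  (λ P → mk⇔ (split P) (join P)) ,
  ≡.cong +_ (length-++ ls)
  where
  split : ∀ P → P ∈ ls ++ ls′ → F P ⊎ G P
  split P p with ∈-++⁻ ls p
  ... | inj₁ p′ = inj₁ (⇔.to (mem P) p′)
  ... | inj₂ p′ = inj₂ (⇔.to (mem′ P) p′)
  join : ∀ P → F P ⊎ G P → P ∈ ls ++ ls′
  join P (inj₁ f) = ∈-++⁺ˡ (⇔.from (mem P) f)
  join P (inj₂ g) = ∈-++⁺ʳ ls (⇔.from (mem′ P) g)

Prefixed : Path → (Path → Set) → Path → Set
Prefixed pre F P = ∃ λ P′ → P ≡ pre ++ P′ × F P′

count-prefix : ∀ pre {F c} → Count F c → Count (Prefixed pre F) c
count-prefix pre {F} (ls , uniq , mem , ≡.refl) =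
  map (pre ++_) ls ,
  Unique.map⁺ (++-cancelˡ pre _ _) uniq ,
  (λ P → mk⇔ (λ p → let P′ , p′ , eq = ∈-map⁻ (pre ++_) p in P′ , eq , ⇔.to (mem P′) p′)
             (λ { (P′ , ≡.refl , f) → ∈-map⁺ (pre ++_) (⇔.from (mem P′) f) })) ,
  ≡.cong +_ (length-map (pre ++_) ls)

-- Peaks and major index under horizontal translation.

sum : List ℕ → ℕ
sum = foldr ℕ._+_ 0

peakXs-shift : ∀ c x P → peakXs (c ℕ.+ x) P ≡ map (c ℕ.+_) (peakXs x P)
peakXs-shift-step : ∀ c x d P → peakXs (c ℕ.+ x ℕ.+ d) P ≡ map (c ℕ.+_) (peakXs (x ℕ.+ d) P)
peakXs-shift-peak : ∀ c x P →
  suc (c ℕ.+ x) ∷ peakXs (suc (c ℕ.+ x)) P ≡ map (c ℕ.+_) (suc x ∷ peakXs (suc x) P)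

peakXs-shift c x []                = ≡.refl
peakXs-shift c x (NE ∷ [])         = ≡.refl
peakXs-shift c x (NE ∷ P@(NE ∷ _)) = peakXs-shift-step c x 1 P
peakXs-shift c x (NE ∷ P@(E ∷ _))  = peakXs-shift-step c x 1 P
peakXs-shift c x (NE ∷ P@(SE ∷ _)) = peakXs-shift-peak c x P
peakXs-shift c x (NE ∷ P@(S ∷ _))  = peakXs-shift-peak c x P
peakXs-shift c x (SE ∷ P)          = peakXs-shift-step c x 1 P
peakXs-shift c x (S ∷ P)           = peakXs-shift-step c x 0 P
peakXs-shift c x (E ∷ P)           = peakXs-shift-step c x 1 P

peakXs-shift-step c x d P = ≡.trans (≡.cong (λ y → peakXs y P) (ℕ.+-assoc c x d))
  (peakXs-shift c (x ℕ.+ d) P)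

peakXs-shift-peak c x P = ≡.trans (≡.cong (λ y → y ∷ peakXs y P) (≡.sym (ℕ.+-suc c x)))
  (≡.cong ((c ℕ.+ suc x) ∷_) (peakXs-shift c (suc x) P))

sum-map-+ : ∀ c xs → sum (map (c ℕ.+_) xs) ≡ length xs ℕ.* c ℕ.+ sum xs
sum-map-+ c []       = ≡.refl
sum-map-+ c (x ∷ xs) = ≡.trans (≡.cong (c ℕ.+ x ℕ.+_) (sum-map-+ c xs))
  (lemma c x (length xs ℕ.* c) (sum xs))
  where
  lemma : ∀ c x y s → c ℕ.+ x ℕ.+ (y ℕ.+ s) ≡ c ℕ.+ y ℕ.+ (x ℕ.+ s)
  lemma = ℕSolver.solve-∀

length-peakXs : ∀ c P → length (peakXs c P) ≡ peaks P
length-peakXs c P = ≡.trans (≡.cong (λ y → length (peakXs y P)) (≡.sym (ℕ.+-identityʳ c)))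
  (≡.trans (≡.cong length (peakXs-shift c 0 P)) (length-map (c ℕ.+_) (peakXs 0 P)))

sum-peakXs : ∀ c P → sum (peakXs c P) ≡ peaks P ℕ.* c ℕ.+ maj P
sum-peakXs c P = ≡.trans (≡.cong (λ y → sum (peakXs y P)) (≡.sym (ℕ.+-identityʳ c)))
  (≡.trans (≡.cong sum (peakXs-shift c 0 P)) (sum-map-+ c (peakXs 0 P)))

sum-peakXs-1 : ∀ P → sum (peakXs 1 P) ≡ peaks P ℕ.+ maj P
sum-peakXs-1 P = ≡.trans (sum-peakXs 1 P) (≡.cong (ℕ._+ maj P) (ℕ.*-identityʳ (peaks P)))

-- A peak follows a `NE` step, so its x-coordinate is at least 1. Hence maj - N is a natural number.
peaks≤sum : ∀ x P → length (peakXs x P) ℕ.≤ sum (peakXs x P)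
peaks≤sum x []                = z≤n
peaks≤sum x (NE ∷ [])         = z≤n
peaks≤sum x (NE ∷ P@(NE ∷ _)) = peaks≤sum (x ℕ.+ 1) P
peaks≤sum x (NE ∷ P@(E ∷ _))  = peaks≤sum (x ℕ.+ 1) P
peaks≤sum x (NE ∷ P@(SE ∷ _)) = s≤s (ℕ.≤-trans (peaks≤sum (suc x) P) (ℕ.m≤n+m _ x))
peaks≤sum x (NE ∷ P@(S ∷ _))  = s≤s (ℕ.≤-trans (peaks≤sum (suc x) P) (ℕ.m≤n+m _ x))
peaks≤sum x (SE ∷ P)          = peaks≤sum (x ℕ.+ 1) P
peaks≤sum x (S ∷ P)           = peaks≤sum (x ℕ.+ 0) P
peaks≤sum x (E ∷ P)           = peaks≤sum (x ℕ.+ 1) P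

maj-excess : ∀ {N m} P → peaks P ≡ N → maj P ≡ m → ∃ λ m′ → m ≡ N ℕ.+ m′
maj-excess P ≡.refl ≡.refl = let m′ , eq = ℕ.m≤n⇒∃[o]m+o≡n (peaks≤sum 0 P) in m′ , ≡.sym eq

endsOK-SE : ∀ P → endsOK (SE ∷ P) ≡ endsOK P
endsOK-SE []      = ≡.refl
endsOK-SE (_ ∷ _) = ≡.refl

endsOK-S : ∀ P → endsOK (S ∷ P) ≡ endsOK P
endsOK-S []      = ≡.refl
endsOK-S (_ ∷ _) = ≡.refl

-- Decomposition of paths by their first steps.

module Decomposition (k : ℕ) where

  record EWalk (h N m j : ℕ) (P : Path) : Set where
    constructor eWalk
    field
      walk   : T (walkOK k false h P)
      ends   : T (endsOK P)
      peaks≡ : peaks P ≡ N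
      maj≡   : maj P ≡ m
      s≡     : sCount P ≡ j

  -- Here m is the exponent maj - N, with the subtraction avoided by requiring major index N + m.
  record GWalk (h N m j : ℕ) (P : Path) : Set where
    constructor gWalk
    field
      eWalk⁺ : EWalk h N (N ℕ.+ m) j P
      first  : T (firstNE P)

  -- The combinatorial side of multiplication by q^n; applied to the number of `S` steps with n = 1,
  -- of multiplication by a.
  Shifted : ℕ → ℕ → (ℕ → Path → Set) → Path → Set
  Shifted n m F P = ∃ λ m′ → m ≡ n ℕ.+ m′ × F m′ P

  shift-maj : ∀ {N m} P → peaks P ≡ N → sum (peakXs 1 P) ≡ m → m ≡ N ℕ.+ maj P
  shift-maj P ≡.refl eq = ≡.trans (≡.sym eq) (sum-peakXs-1 P)

  unshift-maj : ∀ {N m} P → peaks P ≡ N → maj P ≡ m → sum (peakXs 1 P) ≡ N ℕ.+ m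
  unshift-maj P ≡.refl ≡.refl = sum-peakXs-1 P

  startsNE : ∀ {h N m j P} → EWalk h N m j P → T (firstNE P) →
    Shifted N m (λ m′ → GWalk h N m′ j) P
  startsNE {P = P} w@(eWalk _ _ p≡ m≡ _) ne with maj-excess P p≡ m≡
  ... | m′ , ≡.refl = m′ , ≡.refl , gWalk w ne

  after-NE : ∀ h {b P} → T (walkOK k b h (NE ∷ P)) → T (walkOK k true (suc h) P)
  after-NE h w = proj₂ (⇔.to (T-∧ {suc h ℕ.<ᵇ k}) w)

  -- Removing `st` (`SE` or `E`) moves all N peaks one unit to the left, hence q^N. A path that
  -- starts with `NE` is kept whole, and its q^N only undoes the normalisation maj - N of Γ.
  ESplit : Step → (h h′ N m j : ℕ) → Path → Set
  ESplit st h h′ N m j P =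
    Shifted N m (λ m′ → Prefixed (st ∷ []) (EWalk h N m′ j)) P
    ⊎ Shifted N m (λ m′ → GWalk h′ N m′ j) P

  eWalk-suc⇔ : ∀ {h N m j} P → ESplit SE h (suc h) N m j P ⇔ EWalk (suc h) N m j P
  eWalk-suc⇔ {h} {N} {m} {j} P = mk⇔ compose (decompose P)
    where
    compose : ESplit SE h (suc h) N m j P → EWalk (suc h) N m j P
    compose (inj₁ (m′ , ≡.refl , P′ , ≡.refl , eWalk w e p≡ m≡ s≡)) =
      eWalk w (≡.subst T (≡.sym (endsOK-SE P′)) e) (≡.trans (length-peakXs 1 P′) p≡)
        (unshift-maj P′ p≡ m≡) s≡
    compose (inj₂ (m′ , ≡.refl , gWalk w _)) = w
    decompose : ∀ P → EWalk (suc h) N m j P → ESplit SE h (suc h) N m j P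
    decompose []       (eWalk () _ _ _ _)
    decompose (NE ∷ P) w = inj₂ (startsNE w tt)
    decompose (SE ∷ P) (eWalk w e p≡ m≡ s≡) = inj₁ (maj P , shift-maj P p≡′ m≡ , P , ≡.refl ,
      eWalk w (≡.subst T (endsOK-SE P) e) p≡′ ≡.refl s≡)
      where
      p≡′ : peaks P ≡ N
      p≡′ = ≡.trans (≡.sym (length-peakXs 1 P)) p≡
    decompose (S ∷ P)  (eWalk () _ _ _ _)
    decompose (E ∷ P)  (eWalk () _ _ _ _)

  -- With no peaks this fails: the empty path is allowed but the single step `E` is not. One peak
  -- forces the remainder to be nonempty, and then `endsOK` is unaffected by the removed step.
  eWalk-zero⇔ : ∀ {M m j} P → ESplit E 0 0 (suc M) m j P ⇔ EWalk 0 (suc M) m j P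
  eWalk-zero⇔ {M} {m} {j} P = mk⇔ compose (decompose P)
    where
    N = suc M
    compose : ESplit E 0 0 N m j P → EWalk 0 N m j P
    compose (inj₁ (m′ , ≡.refl , P′@(_ ∷ _) , ≡.refl , eWalk w e p≡ m≡ s≡)) =
      eWalk w e (≡.trans (length-peakXs 1 P′) p≡) (unshift-maj P′ p≡ m≡) s≡
    compose (inj₂ (m′ , ≡.refl , gWalk w _)) = w
    decompose : ∀ P → EWalk 0 N m j P → ESplit E 0 0 N m j P
    decompose []       (eWalk _ _ () _ _)
    decompose (NE ∷ P) w = inj₂ (startsNE w tt)
    decompose (SE ∷ P) (eWalk () _ _ _ _)
    decompose (S ∷ P)  (eWalk () _ _ _ _)
    decompose (E ∷ [])  (eWalk _ () _ _ _)
    decompose (E ∷ P@(_ ∷ _)) (eWalk w e p≡ m≡ s≡) = inj₁ (maj P , shift-maj P p≡′ m≡ , P , ≡.refl ,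
      eWalk w e p≡′ ≡.refl s≡)
      where
      p≡′ : peaks P ≡ N
      p≡′ = ≡.trans (≡.sym (length-peakXs 1 P)) p≡

  -- With N = M + 1 the exponent is maj - N. Removing `NE` before another `NE` shifts N peaks by 1.
  -- After `NE`, `S` the lost peak at 1 and M peaks shifted by 1 cancel N exactly, leaving only a
  -- factor a. After `NE`, `SE` the M peaks shift by 2, leaving q^M.
  GSplit : (h M m j : ℕ) → Path → Set
  GSplit h M m j P =
    Shifted (suc M) m (λ m′ → Prefixed (NE ∷ []) (GWalk (suc h) (suc M) m′ j)) P
    ⊎ (Shifted 1 j (λ j′ → Prefixed (NE ∷ S ∷ []) (EWalk h M m j′)) P
    ⊎ Shifted M m (λ m′ → Prefixed (NE ∷ SE ∷ []) (EWalk h M m′ j)) P)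

  gWalk-suc⇔ : ∀ {h M m j} → suc h ℕ.< k → ∀ P → GSplit h M m j P ⇔ GWalk h (suc M) m j P
  gWalk-suc⇔ {h} {M} {m} {j} h<k P = mk⇔ compose (decompose P)
    where
    N = suc M
    NE-ok : ∀ {P} → T (walkOK k true (suc h) P) → T (walkOK k false h (NE ∷ P))
    NE-ok w = ⇔.from T-∧ (ℕ.<⇒<ᵇ h<k , w)
    +-shuffle : ∀ M m → M ℕ.* 2 ℕ.+ m ≡ M ℕ.+ (M ℕ.+ m)
    +-shuffle = ℕSolver.solve-∀
    compose : GSplit h M m j P → GWalk h N m j P
    compose (inj₁ (m′ , ≡.refl , P′@(NE ∷ _) , ≡.refl , gWalk (eWalk w e p≡ m≡ s≡) ne)) =
      gWalk (eWalk (NE-ok {P′} w) e (≡.trans (length-peakXs 1 P′) p≡) (unshift-maj P′ p≡ m≡) s≡) tt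
    compose (inj₂ (inj₁ (j′ , ≡.refl , P′ , ≡.refl , eWalk w e p≡ m≡ s≡))) =
      gWalk (eWalk (NE-ok {S ∷ P′} w) (≡.subst T (≡.sym (endsOK-S P′)) e)
        (≡.cong suc (≡.trans (length-peakXs 1 P′) p≡)) (≡.cong suc (unshift-maj P′ p≡ m≡))
        (≡.cong suc s≡)) tt
    compose (inj₂ (inj₂ (m′ , ≡.refl , P′ , ≡.refl , eWalk w e ≡.refl ≡.refl s≡))) =
      gWalk (eWalk (NE-ok {SE ∷ P′} w) (≡.subst T (≡.sym (endsOK-SE P′)) e)
        (≡.cong suc (length-peakXs 2 P′))
        (≡.cong suc (≡.trans (sum-peakXs 2 P′) (+-shuffle (peaks P′) (maj P′)))) s≡) tt
    decompose : ∀ P → GWalk h N m j P → GSplit h M m j P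
    decompose (NE ∷ [])    (gWalk (eWalk w _ _ _ _) _) = ⊥-elim (after-NE h {false} {[]} w)
    decompose (NE ∷ E ∷ P) (gWalk (eWalk w _ _ _ _) _) = ⊥-elim (after-NE h {false} {E ∷ P} w)
    -- The removed `NE` leaves the flag `true`, but a following `NE` ignores the flag, so the
    -- remainder also counts as a walk with flag `false`.
    decompose (NE ∷ P@(NE ∷ _)) (gWalk (eWalk w e p≡ m≡ s≡) _)
      with startsNE {P = P} (eWalk (after-NE h {false} {P} w) e p≡′
             (≡.sym (ℕ.+-cancelˡ-≡ N m (maj P) (shift-maj P p≡′ m≡))) s≡) tt
      where
      p≡′ : peaks P ≡ N
      p≡′ = ≡.trans (≡.sym (length-peakXs 1 P)) p≡
    ... | m′ , m≡′ , g = inj₁ (m′ , m≡′ , P , ≡.refl , g)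
    decompose (NE ∷ S ∷ P) (gWalk (eWalk w e p≡ m≡ ≡.refl) _) = inj₂ (inj₁ (sCount P , ≡.refl ,
      P , ≡.refl ,
      eWalk (after-NE h {false} {S ∷ P} w) (≡.subst T (endsOK-S P) e) p≡′
        (≡.sym (ℕ.+-cancelˡ-≡ M m (maj P) (shift-maj P p≡′ (ℕ.suc-injective m≡)))) ≡.refl))
      where
      p≡′ : peaks P ≡ M
      p≡′ = ≡.trans (≡.sym (length-peakXs 1 P)) (ℕ.suc-injective p≡)
    decompose (NE ∷ SE ∷ P) (gWalk (eWalk w e p≡ m≡ s≡) _) = inj₂ (inj₂ (maj P , m≡′ , P , ≡.refl ,
      eWalk (after-NE h {false} {SE ∷ P} w) (≡.subst T (endsOK-SE P) e) p≡′ ≡.refl s≡))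
      where
      p≡′ : peaks P ≡ M
      p≡′ = ≡.trans (≡.sym (length-peakXs 2 P)) (ℕ.suc-injective p≡)
      m≡′ : m ≡ M ℕ.+ maj P
      m≡′ = ℕ.+-cancelˡ-≡ M m (M ℕ.+ maj P) (≡.trans (≡.sym (ℕ.suc-injective m≡))
        (≡.trans (sum-peakXs 2 P) (≡.trans (≡.cong (λ p → p ℕ.* 2 ℕ.+ maj P) p≡′) (+-shuffle M (maj P)))))

  gWalk-top : ∀ {h N m j} → suc h ≡ k → ∀ P → ¬ GWalk h N m j P
  gWalk-top {h} eq (NE ∷ P) (gWalk (eWalk w _ _ _ _) _) =
    ℕ.<-irrefl eq (ℕ.<ᵇ⇒< (suc h) k (proj₁ (⇔.to (T-∧ {suc h ℕ.<ᵇ k}) w)))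

  -- After `NE` the height is positive, so the walk can neither stop nor go `E`. A run of `NE` steps
  -- must therefore end in `S` or `SE`, which makes a peak.
  NE-walk-has-peak : ∀ x b h P → T (walkOK k b h (NE ∷ P)) →
    ¬ length (peakXs x (NE ∷ P)) ≡ 0
  NE-walk-has-peak x b h []       w _  = after-NE h {b} {[]} w
  NE-walk-has-peak x b h (E ∷ P)  w _  = after-NE h {b} {E ∷ P} w
  NE-walk-has-peak x b h (NE ∷ P) w eq =
    NE-walk-has-peak (x ℕ.+ 1) true (suc h) P (after-NE h {b} {NE ∷ P} w) eq

  gWalk-no-peaks : ∀ {h m j} P → ¬ GWalk h 0 m j P
  gWalk-no-peaks {h} (NE ∷ P) (gWalk (eWalk w _ p≡ _ _) _) = NE-walk-has-peak 0 false h P w p≡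

  -- Without peaks no `NE` occurs, so from height 0 only `E` steps are possible, and a path may not
  -- end with one.
  ground-walk-empty : ∀ x b P → T (walkOK k b 0 P) → T (endsOK P) → length (peakXs x P) ≡ 0 → P ≡ []
  ground-walk-empty x b []       w e eq = ≡.refl
  ground-walk-empty x b (NE ∷ P) w e eq = ⊥-elim (NE-walk-has-peak x b 0 P w eq)
  ground-walk-empty x b (E ∷ P@(_ ∷ _)) w e eq with () ← ground-walk-empty (x ℕ.+ 1) false P w e eq

  eWalk-ground⇔ : ∀ {m j} P → (P ≡ [] × m ≡ 0 × j ≡ 0) ⇔ EWalk 0 0 m j P
  eWalk-ground⇔ {m} {j} P = mk⇔
    (λ { (≡.refl , ≡.refl , ≡.refl) → eWalk tt tt ≡.refl ≡.refl ≡.refl })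
    to
    where
    to : EWalk 0 0 m j P → P ≡ [] × m ≡ 0 × j ≡ 0
    to (eWalk w e p≡ m≡ s≡) with ground-walk-empty 0 false P w e p≡
    to (eWalk w e p≡ ≡.refl ≡.refl) | ≡.refl = ≡.refl , ≡.refl , ≡.refl

-- The series of the statement inside the ring of power series in q over power series in a.

module Σℤ = AntidiagonalSums ℤ.+-*-commutativeRing
module A = PowerSeries ℤ.+-*-commutativeRing
module Q = PowerSeries A.commutativeRing
module Σₐ = AntidiagonalSums A.commutativeRing

open CommutativeRing Q.commutativeRing
  using ( _≈_; _+_; _*_; 0#; 1#; refl; sym; trans; reflexive; setoid; ring; semiring
        ; *-commutativeSemigroup; +-cong; +-congˡ; *-cong; *-congˡ; *-congʳ
        ; *-assoc; *-identityˡ; distribʳ )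
open AntidiagonalSums Q.commutativeRing
open Exp semiring
open CommutativeSemigroupProperties *-commutativeSemigroup using (x∙yz≈y∙xz)
open RingProperties ring using (-‿distribˡ-*)
open SetoidReasoning setoid

sumℕ-Σᵈ : ∀ n (F : ℕ → ℕ → ℤ) → sumℕ (λ t → F t (n ∸ t)) (suc n) ≡ Σℤ.Σᵈ n F
sumℕ-Σᵈ n F = ≡.trans (Σℤ.foldr-applyUpTo n id (λ t → F t (n ∸ t)))
  (Σℤ.Σᵈ-cong n λ t u eq → ≡.cong (F t) (≡.trans (≡.cong (_∸ t) (≡.sym eq)) (ℕ.m+n∸m≡n t u)))

Σᵈ-pointwise : ∀ n F j → Σₐ.Σᵈ n F j ≡ Σℤ.Σᵈ n (λ t u → F t u j)
Σᵈ-pointwise zero    F j = ≡.refl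
Σᵈ-pointwise (suc n) F j = ≡.cong (λ x → F 0 (suc n) j ℤ.+ x) (Σᵈ-pointwise n (λ t → F (suc t)) j)

*ₚ≈* : ∀ f g → f *ₚ g ≈ f * g
*ₚ≈* f g m j = ≡.trans
  (sumℕ-Σᵈ m λ s s′ → sumℕ (λ t → f s t ℤ.* g s′ (j ∸ t)) (suc j))
  (≡.trans (Σℤ.Σᵈ-cong m λ s s′ _ → sumℕ-Σᵈ j λ t t′ → f s t ℤ.* g s′ t′)
    (≡.sym (Σᵈ-pointwise m (λ s s′ → f s A.⊛ g s′) j)))

-- `upTo` grows at its right end while `prodₚ` unfolds from the left; commutativity brings the new
-- factor to the front.
prodₚ-∷ʳ : ∀ fs f → prodₚ (fs ∷ʳ f) ≈ f * prodₚ fs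
prodₚ-∷ʳ []       f = *ₚ≈* f (prodₚ [])
prodₚ-∷ʳ (g ∷ fs) f = begin
  g *ₚ prodₚ (fs ∷ʳ f)  ≈⟨ *ₚ≈* g (prodₚ (fs ∷ʳ f)) ⟩
  g * prodₚ (fs ∷ʳ f)   ≈⟨ *-congˡ {g} (prodₚ-∷ʳ fs f) ⟩
  g * (f * prodₚ fs)    ≈⟨ x∙yz≈y∙xz g f (prodₚ fs) ⟩
  f * (g * prodₚ fs)    ≈⟨ *-congˡ {f} (*ₚ≈* g (prodₚ fs)) ⟨
  f * (g *ₚ prodₚ fs)   ∎

prodₚ-upTo : ∀ (f : ℕ → PS) n → prodₚ (map f (upTo (suc n))) ≈ f n * prodₚ (map f (upTo n))
prodₚ-upTo f n = begin
  prodₚ (map f (upTo (suc n)))  ≡⟨ ≡.cong (λ ts → prodₚ (map f ts)) (upTo-∷ʳ n) ⟨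
  prodₚ (map f (upTo n ∷ʳ n))   ≡⟨ ≡.cong prodₚ (map-++ f (upTo n) (n ∷ [])) ⟩
  prodₚ (map f (upTo n) ∷ʳ f n) ≈⟨ prodₚ-∷ʳ (map f (upTo n)) (f n) ⟩
  f n * prodₚ (map f (upTo n))  ∎

q a : PS
q = Q.shift 1#
a = Q.const (A.shift (A.const (+ 1)))

q* : ∀ F → q * F ≈ Q.shift F
q* F m j = ≡.trans (Q.shift-⊛ 1# F m j) (shift-cong m j)
  where
  shift-cong : Q.shift (1# * F) ≈ Q.shift F
  shift-cong zero    j = ≡.refl
  shift-cong (suc m) j = *-identityˡ F m j

q^*-low : ∀ c F {m} j → m ℕ.< c → (q ^ c * F) m j ≡ + 0
q^*-low (suc c) F {m} j m<c = ≡.trans (*-assoc q (q ^ c) F m j)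
  (≡.trans (q* (q ^ c * F) m j) (low m m<c))
  where
  low : ∀ m → m ℕ.< suc c → Q.shift (q ^ c * F) m j ≡ + 0
  low zero    _         = ≡.refl
  low (suc m) (s≤s m<c) = q^*-low c F j m<c

q^*-high : ∀ c F m j → (q ^ c * F) (c ℕ.+ m) j ≡ F m j
q^*-high zero    F m j = *-identityˡ F m j
q^*-high (suc c) F m j = ≡.trans (*-assoc q (q ^ c) F (suc c ℕ.+ m) j)
  (≡.trans (q* (q ^ c * F) (suc c ℕ.+ m) j) (q^*-high c F m j))

a*-shift : ∀ F m j → (a * F) m j ≡ A.shift (F m) j
a*-shift F m j = ≡.trans (Q.const-⊛ (A.shift (A.const (+ 1))) F m j)
  (≡.trans (A.shift-⊛ (A.const (+ 1)) (F m) j) (shift-cong j))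
  where
  shift-cong : ∀ j → A.shift (A.const (+ 1) A.⊛ F m) j ≡ A.shift (F m) j
  shift-cong zero    = ≡.refl
  shift-cong (suc j) = A.⊛-identityˡ (F m) j

mono≈q^ : ∀ e → mono e 0 ≈ q ^ e
mono≈q^ zero    zero    zero    = ≡.refl
mono≈q^ zero    zero    (suc j) = ≡.refl
mono≈q^ zero    (suc m) j       = ≡.refl
mono≈q^ (suc e) m       j       = ≡.sym (≡.trans (q* (q ^ e) m j) (shift-mono m))
  where
  shift-mono : ∀ m → Q.shift (q ^ e) m j ≡ mono (suc e) 0 m j
  shift-mono zero    = ≡.refl
  shift-mono (suc m) = ≡.sym (mono≈q^ e m j)

mono≈a : mono 0 1 ≈ a
mono≈a zero    zero          = ≡.refl
mono≈a zero    (suc zero)    = ≡.refl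
mono≈a zero    (suc (suc j)) = ≡.refl
mono≈a (suc m) j             = ≡.refl

qZ≈q^ : ∀ e → qZ (+ e) ≈ q ^ e
qZ≈q^ e m j = ≡.trans (≡.cong (λ b → if b ∧ (j ≡ᵇ 0) then + 1 else + 0) (test e m)) (mono≈q^ e m j)
  where
  test : ∀ e m → ⌊ + e ℤ.≟ + m ⌋ ≡ (m ≡ᵇ e)
  test e m = ≡.trans (isYes≗does (+ e ℤ.≟ + m))
    (does-⇔ (mk⇔ (λ eq → ≡.sym (ℤ.+-injective eq)) (λ eq → ≡.cong +_ (≡.sym eq)))
      (+ e ℤ.≟ + m) (m ℕ.≟ e))

-- With r = n + 1: below degree r only 0 is divisible by r, which gives the term 1; and r divides r
-- + m′ exactly when it divides m′, which gives the shifted copy.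
geom-unfold : ∀ n → geom (suc n) ≈ 1# + q ^ suc n * geom (suc n)
geom-unfold n m j with ℕ.<-≤-connex m (suc n)
... | inj₁ m<r = ≡.trans (low m m<r)
  (≡.trans (≡.sym (ℤ.+-identityʳ _)) (≡.cong (λ x → 1# m j ℤ.+ x) (≡.sym (q^*-low (suc n) (geom (suc n)) j m<r))))
  where
  low : ∀ m → m ℕ.< suc n → geom (suc n) m j ≡ 1# m j
  low zero _ = ≡.trans
    (≡.cong (λ b → if b ∧ (j ≡ᵇ 0) then + 1 else + 0)
      (≡.trans (isYes≗does (suc n ∣? 0)) (dec-true (suc n ∣? 0) (suc n ∣0)))) (mono≈q^ 0 0 j)
  low (suc m) m<r =
    ≡.cong (λ b → if b ∧ (j ≡ᵇ 0) then + 1 else + 0)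
      (≡.trans (isYes≗does (suc n ∣? suc m)) (dec-false (suc n ∣? suc m) (>⇒∤ m<r)))
... | inj₂ r≤m with ℕ.m≤n⇒∃[o]m+o≡n r≤m
...   | m′ , ≡.refl = ≡.trans
  (≡.cong (λ b → if b ∧ (j ≡ᵇ 0) then + 1 else + 0)
    (≡.trans (isYes≗does (suc n ∣? suc n ℕ.+ m′)) (≡.trans
      (does-⇔ (mk⇔ (λ d → ∣m+n∣m⇒∣n d ∣-refl) (∣m∣n⇒∣m+n ∣-refl))
        (suc n ∣? suc n ℕ.+ m′) (suc n ∣? m′))
      (≡.sym (isYes≗does (suc n ∣? m′))))))
  (≡.trans (≡.sym (q^*-high (suc n) (geom (suc n)) m′ j)) (≡.sym (ℤ.+-identityˡ _)))

invQPoch-suc : ∀ n → invQPoch (suc n) ≈ invQPoch n + q ^ suc n * invQPoch (suc n)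
invQPoch-suc n = begin
  invQPoch (suc n)
    ≈⟨ unfold ⟩
  geom (suc n) * invQPoch n
    ≈⟨ *-congʳ {invQPoch n} (geom-unfold n) ⟩
  (1# + q ^ suc n * geom (suc n)) * invQPoch n
    ≈⟨ distribʳ (invQPoch n) 1# (q ^ suc n * geom (suc n)) ⟩
  1# * invQPoch n + q ^ suc n * geom (suc n) * invQPoch n
    ≈⟨ +-cong (*-identityˡ (invQPoch n)) (*-assoc (q ^ suc n) (geom (suc n)) (invQPoch n)) ⟩
  invQPoch n + q ^ suc n * (geom (suc n) * invQPoch n)
    ≈⟨ +-congˡ {invQPoch n} (*-congˡ {q ^ suc n} unfold) ⟨
  invQPoch n + q ^ suc n * invQPoch (suc n) ∎
  where
  unfold : invQPoch (suc n) ≈ geom (suc n) * invQPoch n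
  unfold = prodₚ-upTo (λ m → geom (suc m)) n

aNminusPoch-suc : ∀ n → aNminusPoch (suc n) ≈ (a + q ^ n) * aNminusPoch n
aNminusPoch-suc n = begin
  aNminusPoch (suc n)
    ≈⟨ prodₚ-upTo (λ m → mono 0 1 +ₚ mono m 0) n ⟩
  (mono 0 1 + mono n 0) * aNminusPoch n
    ≈⟨ *-congʳ {aNminusPoch n} (+-cong mono≈a (mono≈q^ n)) ⟩
  (a + q ^ n) * aNminusPoch n ∎

pochhammer : QPochhammer Q.commutativeRing
pochhammer = record
  { q = q
  ; a = a
  ; I = invQPoch
  ; P = aNminusPoch
  ; I-suc = invQPoch-suc
  ; P-suc = aNminusPoch-suc
  }

-- The right-hand sides of the theorem as `eSeries` and `gSeries`.

module Series {k : ℕ} (1≤k : 1 ℕ.≤ k) where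
  open QSeries pochhammer 1≤k public

  scaleₚ≈sgn : ∀ e f → scaleₚ ((ℤ.- + 1) ℤ.^ e) f ≈ sgn e * f
  scaleₚ≈sgn zero    f m j = ≡.trans (ℤ.*-identityˡ (f m j)) (≡.sym (*-identityˡ f m j))
  scaleₚ≈sgn (suc e) f m j = ≡.trans (negate ((ℤ.- + 1) ℤ.^ e) (f m j))
    (≡.trans (≡.cong ℤ.-_ (scaleₚ≈sgn e f m j)) (-‿distribˡ-* (sgn e) f m j))
    where
    negate : ∀ c x → (ℤ.- + 1) ℤ.* c ℤ.* x ≡ ℤ.- (c ℤ.* x)
    negate = solve-∀

  -- The exponent and the two subscripts are abstracted, because they are written differently in the
  -- two right-hand sides.
  summand≈term : ∀ z N t u {x v w} → z ℕ.≤ k → x ≡ expo k z (index N t) → v ≡ u → w ≡ t →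
    scaleₚ ((ℤ.- + 1) ℤ.^ ∣ index N t ∣) (qZ x *ₚ (invQPoch v *ₚ invQPoch w)) ≈ term z N t u
  summand≈term z N t u z≤k ≡.refl ≡.refl ≡.refl = begin
    scaleₚ ((ℤ.- + 1) ℤ.^ ∣ index N t ∣) F
      ≈⟨ scaleₚ≈sgn ∣ index N t ∣ F ⟩
    sgn ∣ index N t ∣ * F
      ≈⟨ *-cong (sgn-index N t) F≈ ⟩
    term z N t u ∎
    where
    x = expo k z (index N t)
    F = qZ x *ₚ (invQPoch u *ₚ invQPoch t)
    F≈ : F ≈ q ^ expoℕ k z (index N t) * (invQPoch u * invQPoch t)
    F≈ = begin
      F ≈⟨ *ₚ≈* (qZ x) (invQPoch u *ₚ invQPoch t) ⟩
      qZ x * (invQPoch u *ₚ invQPoch t)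
        ≈⟨ *-cong {qZ x} {q ^ expoℕ k z (index N t)}
             (≡.subst (λ y → qZ y ≈ q ^ expoℕ k z (index N t)) (+-expoℕ (index N t) 1≤k z≤k)
               (qZ≈q^ (expoℕ k z (index N t))))
             (*ₚ≈* (invQPoch u) (invQPoch t)) ⟩
      q ^ expoℕ k z (index N t) * (invQPoch u * invQPoch t) ∎

  sumₚ-rangeZ : ∀ N L (F : ℤ → PS) → sumₚ (map F (rangeZ N (suc L))) ≈ Σᵈ L (λ t _ → F (index N t))
  sumₚ-rangeZ N L F = begin
    sumₚ (map F (rangeZ N (suc L)))
      ≡⟨ foldr-map _+ₚ_ F 0ₚ (rangeZ N (suc L)) ⟩
    foldr (λ n acc → F n + acc) 0# (map (index N) (upTo (suc L)))
      ≡⟨ foldr-map (λ n acc → F n + acc) (index N) 0# (upTo (suc L)) ⟩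
    foldr (λ t acc → F (index N t) + acc) 0# (upTo (suc L))
      ≈⟨ foldr-applyUpTo L id (λ t → F (index N t)) ⟩
    Σᵈ L (λ t _ → F (index N t)) ∎

  prefactor : ∀ e e′ N F F′ → e ≡ e′ → F ≈ F′ →
    (mono e 0 *ₚ aNminusPoch N) *ₚ F ≈ q ^ e′ * aNminusPoch N * F′
  prefactor e e N F F′ ≡.refl F≈F′ = begin
    (mono e 0 *ₚ aNminusPoch N) *ₚ F   ≈⟨ *ₚ≈* (mono e 0 *ₚ aNminusPoch N) F ⟩
    (mono e 0 *ₚ aNminusPoch N) * F    ≈⟨ *-cong pre F≈F′ ⟩
    q ^ e * aNminusPoch N * F′         ∎
    where
    pre : mono e 0 *ₚ aNminusPoch N ≈ q ^ e * aNminusPoch N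
    pre = trans (*ₚ≈* (mono e 0) (aNminusPoch N)) (*-congʳ {aNminusPoch N} (mono≈q^ e))

  +k-+i : ∀ i → i ℕ.≤ k → + k ℤ.- + i ≡ + (k ∸ i)
  +k-+i i i≤k = ≡.trans (≡.cong (λ k → + k ℤ.- + i) (≡.sym (ℕ.m+[n∸m]≡n i≤k)))
    (t+u-t≡u (+ i) (+ (k ∸ i)))

  rhsE≈eSeries : ∀ i N → 1 ℕ.≤ i → i ℕ.≤ k → rhsE k i N ≈ eSeries (suc (k ∸ i)) N
  rhsE≈eSeries i N 1≤i i≤k = prefactor (binom2ℕ (suc N)) (triangle (suc N)) N _ (eSum z N)
    (binom2ℕ-triangle (suc N))
    (trans (sumₚ-rangeZ N L F) (Σᵈ-cong L {λ t _ → F (index N t)} {term z N} λ t u eq →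
      summand≈term z N t u z≤k (exponent (index N t))
        (≡.cong ∣_∣ (N-index≡u N t u eq)) (≡.cong ∣_∣ (N+index≡t N t))))
    where
    z = suc (k ∸ i)
    L = 2 ℕ.* N
    F : ℤ → PS
    F n = scaleₚ ((ℤ.- + 1) ℤ.^ ∣ n ∣)
      (qZ (+ k ℤ.* n ℤ.* n ℤ.+ n ℤ.* (+ k ℤ.- + i) ℤ.- binom2 n)
        *ₚ (invQPoch ∣ + N ℤ.- n ∣ *ₚ invQPoch ∣ + N ℤ.+ n ∣))
    z≤k : z ℕ.≤ k
    z≤k = ℕ.≤-trans (ℕ.+-monoˡ-≤ (k ∸ i) 1≤i) (ℕ.≤-reflexive (ℕ.m+[n∸m]≡n i≤k))
    exponent : ∀ n → + k ℤ.* n ℤ.* n ℤ.+ n ℤ.* (+ k ℤ.- + i) ℤ.- binom2 n ≡ expo k z n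
    exponent n = ≡.cong (λ h → + k ℤ.* n ℤ.* n ℤ.+ n ℤ.* h ℤ.- binom2 n)
      (≡.trans (+k-+i i i≤k) (≡.sym (t+u-t≡u (+ 1) (+ (k ∸ i)))))

  -- Γ with index i starts at height k - i - 1, so z = k - i. The extra n in (n+1 choose 2) turns
  -- n(k - i) into the n(z - 1) of `expo`.
  rhsG≈gSeries : ∀ i N → i ℕ.< k → rhsG k i N ≈ gSeries (k ∸ i) N
  rhsG≈gSeries i zero i<k = prefactor (binom2ℕ 0) 0 0 0# 0# ≡.refl refl
  rhsG≈gSeries i N@(suc M) i<k = prefactor (binom2ℕ N) (triangle N) N _ (gSum z N)
    (binom2ℕ-triangle N)
    (trans (reflexive (≡.cong (λ L → sumₚ (map F (rangeZ N L))) (2*-suc M)))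
    (trans (sumₚ-rangeZ N L F) (Σᵈ-cong L {λ t _ → F (index N t)} {term z N} λ t u eq →
      summand≈term z N t u (ℕ.m∸n≤m k i) (exponent (index N t))
        (≡.cong ∣_∣ (N-index-1≡u M t u eq)) (≡.cong ∣_∣ (N+index≡t N t)))))
    where
    z = k ∸ i
    L = suc (2 ℕ.* M)
    F : ℤ → PS
    F n = scaleₚ ((ℤ.- + 1) ℤ.^ ∣ n ∣)
      (qZ (+ k ℤ.* n ℤ.* n ℤ.+ n ℤ.* (+ k ℤ.- + i) ℤ.- binom2 (n ℤ.+ + 1))
        *ₚ (invQPoch ∣ + N ℤ.- n ℤ.- + 1 ∣ *ₚ invQPoch ∣ + N ℤ.+ n ∣))
    exponent : ∀ n → + k ℤ.* n ℤ.* n ℤ.+ n ℤ.* (+ k ℤ.- + i) ℤ.- binom2 (n ℤ.+ + 1) ≡ expo k z n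
    exponent n = ≡.trans
      (≡.cong₂ (λ h b → + k ℤ.* n ℤ.* n ℤ.+ n ℤ.* h ℤ.- b) (+k-+i i (ℕ.<⇒≤ i<k)) (binom2-suc n))
      (cancel (+ k) (+ z) n (binom2 n))
      where
      cancel : ∀ k z n b → k ℤ.* n ℤ.* n ℤ.+ n ℤ.* z ℤ.- (b ℤ.+ n)
        ≡ k ℤ.* n ℤ.* n ℤ.+ n ℤ.* (z ℤ.- + 1) ℤ.- b
      cancel = solve-∀

-- Induction on peaks, height and degree.

module Counting {k : ℕ} (1≤k : 1 ≤ k) where
  open Series 1≤k
  open Decomposition k

  -- The enumerations are requested only for m′ with m = n + m′; passing on this equation lets a
  -- caller see m′ < m when n is positive.
  count-q^* : ∀ n (F : ℕ → Path → Set) (G : PS) m j →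
    (∀ m′ → m ≡ n ℕ.+ m′ → Count (F m′) (G m′ j)) → Count (Shifted n m F) ((q ^ n * G) m j)
  count-q^* n F G m j count with ℕ.<-≤-connex m n
  ... | inj₁ m<n = ≡.subst (Count (Shifted n m F)) (≡.sym (q^*-low n G j m<n))
    (count-∅ λ { P (m′ , ≡.refl , _) → ℕ.m+n≮m n m′ m<n })
  ... | inj₂ n≤m with ℕ.m≤n⇒∃[o]m+o≡n n≤m
  ...   | m′ , ≡.refl = count-cong
    (λ P → mk⇔ (λ f → m′ , ≡.refl , f)
      (λ { (m″ , eq , f) → ≡.subst (λ m → F m P) (≡.sym (ℕ.+-cancelˡ-≡ n m′ m″ eq)) f }))
    (≡.sym (q^*-high n G m′ j)) (count m′ ≡.refl)

  count-a* : ∀ (F : ℕ → Path → Set) (G : PS) m j →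
    (∀ j′ → Count (F j′) (G m j′)) → Count (Shifted 1 j F) ((a * G) m j)
  count-a* F G m zero    count = ≡.subst (Count (Shifted 1 0 F))
    (≡.sym (a*-shift G m 0)) (count-∅ λ { P (_ , () , _) })
  count-a* F G m (suc j) count = count-cong
    (λ P → mk⇔ (λ f → j , ≡.refl , f) (λ { (_ , ≡.refl , f) → f }))
    (≡.sym (a*-shift G m (suc j))) (count j)

  ECounted GCounted : ℕ → Set
  ECounted N = ∀ h → h < k → ∀ m j → Count (EWalk h N m j) (eSeries (suc h) N m j)
  GCounted N = ∀ h → h < k → ∀ m j → Count (GWalk h N m j) (gSeries (suc h) N m j)

  x+x≡0⇒x≡0 : ∀ x → x ℤ.+ x ≡ + 0 → x ≡ + 0
  x+x≡0⇒x≡0 (+ zero) _ = ≡.refl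

  gCounted-zero : GCounted 0
  gCounted-zero h _ m j = ≡.subst (Count (GWalk h 0 m j))
    (≡.sym (gSeries-zero (suc h) m j)) (count-∅ gWalk-no-peaks)

  gCounted-suc : ∀ {M} → ECounted M → GCounted (suc M)
  gCounted-suc {M} eCounted h h<k = let d , eq = ℕ.m≤n⇒∃[o]m+o≡n h<k in descend d h eq
    where
    N = suc M
    -- The number d is the distance from h to the top height k - 1, where no path can start with
    -- `NE`.
    descend : ∀ d h → suc h ℕ.+ d ≡ k → ∀ m j → Count (GWalk h N m j) (gSeries (suc h) N m j)
    descend zero h eq m j = ≡.subst (Count (GWalk h N m j))
      (≡.sym (≡.trans (≡.cong (λ z → gSeries z N m j) top)
        (x+x≡0⇒x≡0 _ (gSeries-antisym N m j))))
      (count-∅ (gWalk-top top))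
      where
      top : suc h ≡ k
      top = ≡.trans (≡.sym (ℕ.+-identityʳ (suc h))) eq
    descend (suc d) h eq m j = count-cong (gWalk-suc⇔ 1+h<k) (≡.sym (gSeries-suc M 1+h<k m j))
      (count-⊎ disjoint₁
        (count-q^* N _ (gSeries (suc (suc h)) N) m j λ m′ _ →
          count-prefix _ (descend d (suc h) eq′ m′ j))
        (count-⊎ disjoint₂
          (count-a* _ (eSeries (suc h) M) m j λ j′ →
            count-prefix _ (eCounted h h<k′ m j′))
          (count-q^* M _ (eSeries (suc h) M) m j λ m′ _ →
            count-prefix _ (eCounted h h<k′ m′ j))))
      where
      eq′ : suc (suc h) ℕ.+ d ≡ k
      eq′ = ≡.trans (≡.sym (ℕ.+-suc (suc h) d)) eq
      1+h<k : suc h < k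
      1+h<k = ≡.subst (suc (suc h) ≤_) eq′ (ℕ.m≤m+n (suc (suc h)) d)
      h<k′ : h < k
      h<k′ = ℕ.<⇒≤ 1+h<k
      disjoint₁ : ∀ P → Shifted N m (λ m′ → Prefixed (NE ∷ []) (GWalk (suc h) N m′ j)) P →
        ¬ (Shifted 1 j (λ j′ → Prefixed (NE ∷ S ∷ []) (EWalk h M m j′)) P
          ⊎ Shifted M m (λ m′ → Prefixed (NE ∷ SE ∷ []) (EWalk h M m′ j)) P)
      disjoint₁ _ (_ , _ , _ , ≡.refl , gWalk _ ()) (inj₁ (_ , _ , _ , ≡.refl , _))
      disjoint₁ _ (_ , _ , _ , ≡.refl , gWalk _ ()) (inj₂ (_ , _ , _ , ≡.refl , _))
      disjoint₂ : ∀ P → Shifted 1 j (λ j′ → Prefixed (NE ∷ S ∷ []) (EWalk h M m j′)) P →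
        ¬ Shifted M m (λ m′ → Prefixed (NE ∷ SE ∷ []) (EWalk h M m′ j)) P
      disjoint₂ _ (_ , _ , _ , ≡.refl , _) (_ , _ , _ , () , _)

  ESplit-disjoint : ∀ {st h h′ N m j} → ¬ T (isNE st) → ∀ P →
    Shifted N m (λ m′ → Prefixed (st ∷ []) (EWalk h N m′ j)) P →
    ¬ Shifted N m (λ m′ → GWalk h′ N m′ j) P
  ESplit-disjoint ¬NE _ (_ , _ , _ , ≡.refl , _) (_ , _ , gWalk _ ne) = ¬NE ne

  eSeries-ground : eSeries 1 0 ≈ 1#
  eSeries-ground = trans
    (*-cong {q ^ 0 * aNminusPoch 0} {1#}
      (trans (*-identityˡ (aNminusPoch 0)) (mono≈q^ 0))
      (trans (*-identityˡ (q ^ expoℕ k 1 (+ 0) * (invQPoch 0 * invQPoch 0)))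
        (*-cong (λ m j → ≡.cong (λ e → (q ^ e) m j) (≡.cong ℤ.∣_∣ (vanish (+ k))))
          (trans (*-cong (mono≈q^ 0) (mono≈q^ 0)) (*-identityˡ 1#)))))
    (trans (*-identityˡ (1# * 1#)) (*-identityˡ 1#))
    where
    vanish : ∀ k → k ℤ.* + 0 ℤ.* + 0 ℤ.+ + 0 ℤ.* (+ 1 ℤ.- + 1) ℤ.- + 0 ≡ + 0
    vanish = solve-∀

  eCounted-ground : ∀ m j → Count (EWalk 0 0 m j) (eSeries 1 0 m j)
  eCounted-ground m j = count-cong eWalk-ground⇔ (≡.sym (eSeries-ground m j)) (count m j)
    where
    count : ∀ m j → Count (λ P → P ≡ [] × m ≡ 0 × j ≡ 0) (1# m j)
    count zero    zero    = count-cong (λ P → mk⇔ (λ eq → eq , ≡.refl , ≡.refl) proj₁) ≡.refl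
      (count-singleton [])
    count zero    (suc j) = count-∅ λ { _ (_ , _ , ()) }
    count (suc m) j       = count-∅ λ { _ (_ , () , _) }

  eCounted : ∀ {N} → GCounted N → ECounted N
  eCounted {zero}  gCounted zero _ m j = eCounted-ground m j
  eCounted {suc M} gCounted zero 0<k m j =
    -- Strong induction on the degree: removing an `E` step leaves m′ with m = `suc M` + m′, hence
    -- m′ < m.
    <-rec (λ m → Count (EWalk 0 N m j) (eSeries 1 N m j)) step m
    where
    N = suc M
    step : ∀ m → (∀ {m′} → m′ < m → Count (EWalk 0 N m′ j) (eSeries 1 N m′ j)) →
      Count (EWalk 0 N m j) (eSeries 1 N m j)
    step m rec = count-cong eWalk-zero⇔ (≡.sym (eSeries-one N m j))
      (count-⊎ (ESplit-disjoint {st = E} λ ())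
        (count-q^* N _ (eSeries 1 N) m j λ { m′ ≡.refl →
          count-prefix _ (rec (s≤s (ℕ.m≤n+m m′ M))) })
        (count-q^* N _ (gSeries 1 N) m j λ m′ _ → gCounted 0 0<k m′ j))
  eCounted {N} gCounted (suc h) h<k m j = count-cong eWalk-suc⇔ (≡.sym (eSeries-suc N h<k m j))
    (count-⊎ (ESplit-disjoint {st = SE} λ ())
      (count-q^* N _ (eSeries (suc h) N) m j λ m′ _ →
        count-prefix _ (eCounted gCounted h (ℕ.<⇒≤ h<k) m′ j))
      (count-q^* N _ (gSeries (suc (suc h)) N) m j λ m′ _ → gCounted (suc h) h<k m′ j))

  gCounted : ∀ N → GCounted N
  gCounted zero    = gCounted-zero
  gCounted (suc M) = gCounted-suc (eCounted (gCounted M))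

-- Transfer to the conditions of the statement.

EPath⇔EWalk : ∀ {k i N m j} → let open Decomposition k in k ∸ i < k → ∀ P →
  EWalk (k ∸ i) N m j P ⇔ (EPath k i N P × + maj P ≡ + m × sCount P ≡ j)
EPath⇔EWalk {k} {i} h<k P = mk⇔
  (λ { (eWalk w e p≡ m≡ s≡) →
       (⇔.from T-∧ (ℕ.<⇒<ᵇ h<k , ⇔.from T-∧ (w , e)) , p≡) , ≡.cong +_ m≡ , s≡ })
  (λ { ((ok , p≡) , m≡ , s≡) → let w , e = ⇔.to T-∧ (proj₂ (⇔.to (T-∧ {(k ∸ i) ℕ.<ᵇ k}) ok)) in
       eWalk w e p≡ (ℤ.+-injective m≡) s≡ })
  where open Decomposition k

GPath⇔GWalk : ∀ {k i N m j} → let open Decomposition k in k ∸ suc i < k → ∀ P →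
  GWalk (k ∸ suc i) N m j P ⇔ (GPath k i N P × + maj P - + N ≡ + m × sCount P ≡ j)
GPath⇔GWalk {k} {i} {N} {m} {j} h<k P = mk⇔ to from
  where
  open Decomposition k
  add-sub : ∀ N m → (N ℤ.+ m) ℤ.- N ≡ m
  add-sub = solve-∀
  sub-add : ∀ N x → x ≡ N ℤ.+ (x ℤ.- N)
  sub-add = solve-∀
  to : GWalk (k ∸ suc i) N m j P → GPath k i N P × + maj P - + N ≡ + m × sCount P ≡ j
  to (gWalk w ne) = let (ok , p≡) , m≡ , s≡ = ⇔.to (EPath⇔EWalk {i = suc i} h<k P) w in
    (ok , p≡ , ne) , ≡.trans (≡.cong (_- + N) m≡) (add-sub (+ N) (+ m)) , s≡
  from : GPath k i N P × + maj P - + N ≡ + m × sCount P ≡ j → GWalk (k ∸ suc i) N m j P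
  from ((ok , p≡ , ne) , m≡ , s≡) = gWalk (⇔.from (EPath⇔EWalk {i = suc i} h<k P)
    ((ok , p≡) , ≡.trans (sub-add (+ N) (+ maj P)) (≡.cong (λ x → + N ℤ.+ x) m≡) , s≡)) ne

theorem3p2 : (k N : ℕ) → 1 ≤ k →
    ((i : ℕ) → 1 ≤ i → i ≤ k →
    GenFunIs (EPath k i N) (λ P → + maj P) sCount (rhsE k i N))
    × ((i : ℕ) → i < k →
    GenFunIs (GPath k i N) (λ P → + maj P - + N) sCount (rhsG k i N))
theorem3p2 k N 1≤k = eCase , gCase
  where
  open Series 1≤k
  open Counting 1≤k
  eCase : (i : ℕ) → 1 ≤ i → i ≤ k → GenFunIs (EPath k i N) (λ P → + maj P) sCount (rhsE k i N)
  eCase i 1≤i i≤k m j = count-cong (EPath⇔EWalk {i = i} h<k) (≡.sym (rhsE≈eSeries i N 1≤i i≤k m j))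
    (eCounted (gCounted N) (k ∸ i) h<k m j)
    where
    h<k : k ∸ i < k
    h<k = ℕ.∸-monoʳ-< 1≤i i≤k
  gCase : (i : ℕ) → i < k → GenFunIs (GPath k i N) (λ P → + maj P - + N) sCount (rhsG k i N)
  gCase i i<k m j = count-cong (GPath⇔GWalk {i = i} h<k)
    -- `gCounted` gives z = suc (k ∸ suc i), while the right-hand side has z = k ∸ i; these agree
    -- because i < k.
    (≡.trans (≡.cong (λ z → gSeries z N m j) (≡.sym (ℕ.+-∸-assoc 1 i<k)))
      (≡.sym (rhsG≈gSeries i N i<k m j)))
    (gCounted N (k ∸ suc i) h<k m j)
    where
    h<k : k ∸ suc i < k
    h<k = ℕ.∸-monoʳ-< (s≤s z≤n) i<k
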